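{- Every forward-greedy randomized algorithm for online graph exploration on cycles has competitive ratio at least $\frac{1+\sqrt{2}}{2}\approx 1.207$.
   Context: **Online exploration of cycles.** The input is a cycle $\Gamma$ (a cycle graph on $n\ge 3$ vertices) with non-negative edge weights $w$, together with a starting vertex $s$. An agent starts at $s$ and initially has no knowledge of the graph other than that it is a cycle. Whenever it visits a vertex for the first time (including $s$ at the start), it learns the identifiers of the adjacent vertices and the weights of the incident edges. The agent repeatedly decides which known edge to traverse next, based on the information revealed so far (and, for a randomized algorithm, on random choices); traversing an edge costs its weight. The agent must visit all vertices and return to $s$. Let $\mathrm{Alg}(\Gamma,s)$ be the total cost of an algorithm $\mathrm{Alg}$ (a random variable if $\mathrm{Alg}$ is randomized), and let $\mathrm{Opt}(\Gamma)$ be the minimum length of a closed walk in $\Gamma$ visiting every vertex. A randomized algorithm $\mathrm{Alg}$ is $\rho$-competitive (on cycles, against an oblivious adversary) if $\mathbb{E}[\mathrm{Alg}(\Gamma,s)]\le \rho\cdot \mathrm{Opt}(\Gamma)$ for every fixed weighted cycle $\Gamma$ and every starting vertex $s$. The competitive ratio of $\mathrm{Alg}$ is the infimum of all such $\rho$. **Exploration steps.** A boundary edge is an edge with one explored (i.e. visited) and one unexplored endpoint. In each step the agent chooses a boundary edge, travels through the explored part (a path) to its explored endpoint, and traverses it. The explored part is a path until everything is visited, so there are exactly two boundary edges, one at each end; after each step the agent is at the explored endpoint of one of them, called the direct boundary edge; the other one is called the backtracking boundary edge. The agent "moves directly" if it chooses the direct boundary edge and "backtracks" otherwise. While the agent is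 at $v$ after at least one step and not all vertices are visited, let $b$ be the weight of the direct boundary edge, let $a$ be the length of the explored path from $v$ to $s$, and let $d$ be the length of the path from $s$, through the explored part on the other side, to the unexplored endpoint of the backtracking boundary edge (including that edge's weight). Thus a direct move costs $b$ and backtracking costs $a+d$. **Forward-greedy.** A randomized algorithm for online cycle exploration is forward-greedy if, from the second step until all vertices are visited, the agent moves directly (with probability $1$) whenever $b\le a+d$. The algorithm may use any decision rule in the first step, as well as after the last vertex has been visited. -}

module Defs where

open import Algebra.Structures using (IsCommutativeRing)
open import Data.Bool.Base using (if_then_else_)
open import Data.Fin.Base using (Fin; toℕ)
open import Data.List.Base using (List; []; _∷_; length)
open import Data.List.Membership.Propositional using (_∈_)
open import Data.Nat.Base as ℕ using (ℕ; zero; suc; pred; NonZero; >-nonZero; z<s; _<ᵇ_)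
open import Data.Nat.DivMod using (_mod_)
open import Data.Nat.Properties using (<-≤-trans)
open import Data.Product.Base using (Σ; ∃; _×_; _,_)
open import Function.Definitions using (Injective)
open import Relation.Binary.PropositionalEquality.Core using (_≡_; _≢_)
open import Relation.Binary.Structures using (IsDecTotalOrder)
open import Relation.Nullary.Negation.Core using (¬_)

-- The real numbers, axiomatised as a Dedekind-complete ordered field.  The
-- order is decidable, as it is classically.
record RealNumbers : Set₁ where
  infixl 6 _+_ _-_
  infixl 7 _*_
  infix  8 -_
  infix  9 _⁻¹
  infix  4 _≤_ _<_
  field
    ℝ       : Set
    _+_ _*_ : ℝ → ℝ → ℝ
    -_      : ℝ → ℝ
    0ℝ 1ℝ   : ℝ
    _⁻¹     : ℝ → ℝ   -- the value at 0ℝ is unconstrained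
    _≤_     : ℝ → ℝ → Set

    isCommutativeRing : IsCommutativeRing _≡_ _+_ _*_ -_ 0ℝ 1ℝ
    0≢1               : 0ℝ ≢ 1ℝ
    ⁻¹-inverse        : ∀ x → x ≢ 0ℝ → x * x ⁻¹ ≡ 1ℝ

    isDecTotalOrder   : IsDecTotalOrder _≡_ _≤_
    +-monoˡ-≤         : ∀ z {x y} → x ≤ y → x + z ≤ y + z
    *-nonNegative     : ∀ {x y} → 0ℝ ≤ x → 0ℝ ≤ y → 0ℝ ≤ x * y

  IsUpperBound : (ℝ → Set) → ℝ → Set
  IsUpperBound S u = ∀ x → S x → x ≤ u

  IsSupremum : (ℝ → Set) → ℝ → Set
  IsSupremum S u = IsUpperBound S u × (∀ v → IsUpperBound S v → u ≤ v)

  field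
    complete : ∀ S → ∃ S → ∃ (IsUpperBound S) → ∃ (IsSupremum S)

  _<_ : ℝ → ℝ → Set
  x < y = ¬ (y ≤ x)

  _-_ : ℝ → ℝ → ℝ
  x - y = x + (- y)

  2ℝ : ℝ
  2ℝ = 1ℝ + 1ℝ

  -- ∑[ n ] f  =  f 0 + ⋯ + f (n − 1)
  ∑[_]_ : ℕ → (ℕ → ℝ) → ℝ
  ∑[ zero  ] f = 0ℝ
  ∑[ suc n ] f = ∑[ n ] f + f n

  IsProbability : ℝ → Set
  IsProbability p = 0ℝ ≤ p × p ≤ 1ℝ

  -- A discrete probability distribution; outcomes may repeat.
  record Lottery (A : Set) : Set where
    field
      prob    : ℕ → ℝ
      outcome : ℕ → A
      prob≥0  : ∀ k → 0ℝ ≤ prob k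
      total   : IsSupremum (λ x → ∃ λ N → x ≡ ∑[ N ] prob) 1ℝ


module Exploration (ℛ : RealNumbers) where
  open RealNumbers ℛ

  data Dir : Set where
    cw ccw : Dir

  flip : Dir → Dir
  flip cw  = ccw
  flip ccw = cw

  -- The positions 0, …, size − 1 and the orientation cw / ccw describe the
  -- input and are not visible to the agent, who only sees identifiers.
  -- `weight i` is the weight of the edge between position i and its
  -- clockwise neighbour.
  record Cycle : Set where
    field
      size           : ℕ
      3≤size         : 3 ℕ.≤ size
      name           : Fin size → ℕ
      name-injective : Injective _≡_ _≡_ name
      weight         : Fin size → ℝ
      weight≥0       : ∀ i → 0ℝ ≤ weight i

    instance
      size-nonZero : NonZero size
      size-nonZero = >-nonZero (<-≤-trans z<s 3≤size)

    Vertex : Set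
    Vertex = Fin size

    move : Dir → Vertex → Vertex
    move cw  v = suc (toℕ v) mod size
    move ccw v = (toℕ v ℕ.+ pred size) mod size

    edge : Dir → Vertex → ℝ
    edge cw  v = weight v
    edge ccw v = weight (move ccw v)

    -- A walk is given by its first vertex and its sequence of directions.

    walkEnd : Vertex → List Dir → Vertex
    walkEnd v []       = v
    walkEnd v (d ∷ ds) = walkEnd (move d v) ds

    walkLength : Vertex → List Dir → ℝ
    walkLength v []       = 0ℝ
    walkLength v (d ∷ ds) = edge d v + walkLength (move d v) ds

    walkVertices : Vertex → List Dir → List Vertex
    walkVertices v []       = v ∷ []
    walkVertices v (d ∷ ds) = v ∷ walkVertices (move d v) ds

    IsTour : Vertex → List Dir → Set
    IsTour v ds = walkEnd v ds ≡ v × (∀ u → u ∈ walkVertices v ds)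

    IsOpt : ℝ → Set
    IsOpt o = (Σ Vertex λ v → Σ (List Dir) λ ds → IsTour v ds × walkLength v ds ≡ o)
            × (∀ v ds → IsTour v ds → o ≤ walkLength v ds)

  -- What is revealed when a vertex is first visited.  The incident edges are
  -- listed by increasing identifier of the other endpoint, so that a view
  -- carries no information about the orientation.
  record View : Set where
    constructor view
    field
      self    : ℕ
      lo hi   : ℕ × ℝ

  data Port : Set where
    lo hi : Port

  -- In `arrive h u x` the agent, having seen h, has just traversed the
  -- boundary edge whose explored endpoint has identifier u, and sees x.
  data History : Set where
    start  : View → History
    arrive : History → ℕ → View → History

  module Ports (Γ : Cycle) where
    open Cycle Γ

    toward : Vertex → Port → Dir
    toward v lo = if name (move cw v) <ᵇ name (move ccw v) then cw else ccw
    toward v hi = flip (toward v lo)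

    -- identifier of the other endpoint and weight
    incident : Vertex → Port → ℕ × ℝ
    incident v p = name (move (toward v p) v) , edge (toward v p) v

    viewAt : Vertex → View
    viewAt v = view (name v) (incident v lo) (incident v hi)

    directions : Vertex → List Port → List Dir
    directions v []       = []
    directions v (p ∷ ps) = toward v p ∷ directions (move (toward v p) v) ps

  -- The exploration of Γ from s.  The trajectory of the agent is the list of
  -- the sides of s on which the successive steps extended the explored part,
  -- most recent step first.
  module Run (Γ : Cycle) (s : Cycle.Vertex Γ) where
    open Cycle Γ
    open Ports Γ public

    Trajectory : Set
    Trajectory = List Dir

    -- number of vertices other than s explored on the given side
    explored : Dir → Trajectory → ℕ
    explored d   []        = 0
    explored cw  (cw  ∷ τ) = suc (explored cw τ)
    explored cw  (ccw ∷ τ) = explored cw τ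
    explored ccw (cw  ∷ τ) = explored ccw τ
    explored ccw (ccw ∷ τ) = suc (explored ccw τ)

    at : Dir → ℕ → Vertex
    at d zero    = s
    at d (suc k) = move d (at d k)

    -- length of the path consisting of the first k edges on side d of s
    arm : Dir → ℕ → ℝ
    arm d k = ∑[ k ] λ i → edge d (at d i)

    current : Trajectory → Vertex
    current []      = s
    current (d ∷ τ) = at d (explored d (d ∷ τ))

    history : Trajectory → History
    history []      = start (viewAt s)
    history (d ∷ τ) = arrive (history τ) (name (at d (explored d τ)))
                             (viewAt (current (d ∷ τ)))

    -- Below, e is the side of the last step, so the direct boundary edge is the
    -- one on side e and the backtracking boundary edge the one on side flip e,
    -- whose weight is included in distanceBeyondStart.

    directWeight : Dir → Trajectory → ℝ
    directWeight e τ = edge e (at e (explored e τ))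

    distanceToStart : Dir → Trajectory → ℝ
    distanceToStart e τ = arm e (explored e τ)

    distanceBeyondStart : Dir → Trajectory → ℝ
    distanceBeyondStart e τ = arm (flip e) (suc (explored (flip e) τ))

    directCost backtrackCost : Dir → Trajectory → ℝ
    directCost    e τ = directWeight e τ
    backtrackCost e τ = distanceToStart e τ + distanceBeyondStart e τ

    stepCost : Trajectory → Dir → ℝ
    stepCost []        d   = edge d s
    stepCost (cw  ∷ τ) cw  = directCost    cw  (cw  ∷ τ)
    stepCost (cw  ∷ τ) ccw = backtrackCost cw  (cw  ∷ τ)
    stepCost (ccw ∷ τ) cw  = backtrackCost ccw (ccw ∷ τ)
    stepCost (ccw ∷ τ) ccw = directCost    ccw (ccw ∷ τ)

    explorationCost : Trajectory → ℝ
    explorationCost []      = 0ℝ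
    explorationCost (d ∷ τ) = explorationCost τ + stepCost τ d

    -- number of steps after which all vertices are visited
    steps : ℕ
    steps = pred size

    returnLength : Trajectory → List Port → ℝ
    returnLength τ ps = walkLength (current τ) (directions (current τ) ps)

    EndsAtStart : Trajectory → List Port → Set
    EndsAtStart τ ps = walkEnd (current τ) (directions (current τ) ps) ≡ s

  -- A randomized algorithm in behavioural form: at each history it randomizes
  -- its next decision.  Nothing is revealed after the last vertex has been
  -- visited, so all remaining decisions amount to a random choice among the
  -- (countably many) walks to s.
  record Algorithm : Set where
    field
      -- probability that the first step is along the edge listed first
      first           : View → ℝ
      -- probability of moving directly in a later step
      direct          : History → ℝ
      return          : History → Lottery (List Port)

      first-prob      : ∀ x → IsProbability (first x)
      direct-prob     : ∀ h → IsProbability (direct h)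
      return-to-start : ∀ Γ s τ → length τ ≡ Run.steps Γ s → ∀ k →
                        Run.EndsAtStart Γ s τ
                          (Lottery.outcome (return (Run.history Γ s τ)) k)

  module Execution (A : Algorithm) (Γ : Cycle) (s : Cycle.Vertex Γ) where
    open Algorithm A
    open Cycle Γ
    open Run Γ s public

    portProb : Port → ℝ
    portProb lo = first (viewAt s)
    portProb hi = 1ℝ - first (viewAt s)

    stepProb : Trajectory → Dir → ℝ
    stepProb [] d with toward s lo | d
    ... | cw  | cw  = portProb lo
    ... | cw  | ccw = portProb hi
    ... | ccw | cw  = portProb hi
    ... | ccw | ccw = portProb lo
    stepProb (cw  ∷ τ) cw  = direct (history (cw ∷ τ))
    stepProb (cw  ∷ τ) ccw = 1ℝ - direct (history (cw ∷ τ))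
    stepProb (ccw ∷ τ) cw  = 1ℝ - direct (history (ccw ∷ τ))
    stepProb (ccw ∷ τ) ccw = direct (history (ccw ∷ τ))

    reachProb : Trajectory → ℝ
    reachProb []      = 1ℝ
    reachProb (d ∷ τ) = reachProb τ * stepProb τ d

    -- probability and length of the k-th return walk after trajectory τ
    returnProb returnCost : Trajectory → ℕ → ℝ
    returnProb τ k = Lottery.prob (return (history τ)) k
    returnCost τ k = returnLength τ (Lottery.outcome (return (history τ)) k)

    -- sum of f over all trajectories of m steps
    sumTrajectories : ℕ → (Trajectory → ℝ) → ℝ
    sumTrajectories zero    f = f []
    sumTrajectories (suc m) f = sumTrajectories m λ τ → f (cw ∷ τ) + f (ccw ∷ τ)

    -- The expected total cost, as a series truncated to the first N outcomes
    -- of each return lottery.  It is non-decreasing in N.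
    truncatedCost : ℕ → ℝ
    truncatedCost N = sumTrajectories steps λ τ →
      reachProb τ * ∑[ N ] λ k → returnProb τ k * (explorationCost τ + returnCost τ k)

    -- The expectation is the supremum of the truncated costs, possibly
    -- infinite.
    ExpectedCost≤ : ℝ → Set
    ExpectedCost≤ c = ∀ N → truncatedCost N ≤ c

    ForwardGreedyAt : Dir → Trajectory → Set
    ForwardGreedyAt e τ =
      length (e ∷ τ) ℕ.< steps →
      0ℝ < reachProb (e ∷ τ) →
      directCost e (e ∷ τ) ≤ backtrackCost e (e ∷ τ) →
      direct (history (e ∷ τ)) ≡ 1ℝ

  Competitive : Algorithm → ℝ → Set
  Competitive A ρ = ∀ Γ s o → Cycle.IsOpt Γ o → Execution.ExpectedCost≤ A Γ s (ρ * o)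

  -- The infimum of a set of reals (+∞ if the set is empty) is at least c
  -- exactly if c is a lower bound of the set.
  CompetitiveRatio≥ : Algorithm → ℝ → Set
  CompetitiveRatio≥ A c = ∀ ρ → Competitive A ρ → c ≤ ρ

  -- The step after `e ∷ τ` is at least the second one, and it is taken only if
  -- some vertex is still unvisited.  Histories of probability zero are exempt.
  ForwardGreedy : Algorithm → Set
  ForwardGreedy A = ∀ Γ s e τ → Execution.ForwardGreedyAt A Γ s e τ

{-# OPTIONS --safe #-}

-- Let M be a power of two and H = (1 + √2) M.  The agent starts next to a path
-- of length M whose edges double in length, so that a forward-greedy agent that
-- has entered it walks to its far end.  There it sees an edge of weight H,
-- behind which lies a vertex X; the edge of X on the other side has weight
-- β = 0 or β = M + H, and the agent cannot tell which.  If β = 0, crossing H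
-- costs about M + H although 2 M suffices; if β = M + H, backtracking costs
-- about 4 M + 2 H although 2 M + 2 H suffices.  Weighting these two cycles by
-- 2 : √2 makes the decision irrelevant, and the ratio is (1 + √2) / 2.
--
-- The agent may also start to the other side.  There, after an edge of weight 1,
-- it sees an edge of weight δ with 1 ≪ δ ≪ M.  Crossing it has probability
-- O(1 / δ), because the cycle might consist of this edge and three edges of
-- total weight 2; and after backtracking the agent enters the path as before.
-- With M = δ² all errors vanish relative to M as δ → ∞.
module Submission where

open import Algebra.Bundles using (CommutativeRing)
import Algebra.Properties.Ring as RingProperties
import Algebra.Properties.Semiring.Mult.TCOptimised as Mult
import Algebra.Solver.Ring.NaturalCoefficients.Default as NaturalCoefficients
open import Data.Bool.Base using (Bool; true; false; if_then_else_)
import Data.Bool.Properties as Bool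
open import Data.Empty using (⊥)
open import Data.Fin.Base using (Fin; toℕ; zero; suc)
open import Data.Fin.Properties using (toℕ<n; toℕ-fromℕ<; toℕ-injective)
open import Data.List.Base using (List; []; _∷_; _++_; length; replicate)
open import Data.List.Membership.Propositional using (_∈_)
open import Data.List.Relation.Unary.Any using (here; there)
open import Data.Nat.Base as ℕ using (ℕ; zero; suc; pred; z≤n; s≤s; _<ᵇ_)
open import Data.Nat.DivMod using (_mod_; _%_; m<n⇒m%n≡m; n%n≡0; [m+n]%n≡m%n)
import Data.Nat.Properties as ℕₚ
open import Data.Product.Base using (∃; _×_; _,_; proj₁; proj₂)
open import Data.Sum.Base using (_⊎_; inj₁; inj₂)
open import Defs
open import Function.Base using (_∘_)
open import Function.Bundles using (mk⇔)
open import Relation.Binary.Definitions using (tri<; tri≈; tri>)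
open import Relation.Binary.PropositionalEquality
open import Relation.Binary.Structures using (IsDecTotalOrder)
open import Relation.Nullary using (Dec; ¬_; yes; no; does)
open import Relation.Nullary.Decidable using (_×-dec_; _⊎-dec_; ¬?; decidable-stable; does-⇔; dec-true; dec-false)
open import Relation.Nullary.Negation using (contradiction)

-- Ordered-field arithmetic, powers of two and finite sums.

module OrderedField (ℛ : RealNumbers) where
  open RealNumbers ℛ
  open IsDecTotalOrder isDecTotalOrder public
    using (_≤?_)
    renaming (refl to ≤-refl; reflexive to ≤-reflexive; trans to ≤-trans; antisym to ≤-antisym; total to ≤-total)

  commutativeRing : CommutativeRing _ _
  commutativeRing = record { isCommutativeRing = isCommutativeRing }

  open CommutativeRing commutativeRing public
    using (+-comm; +-assoc; +-identityˡ; +-identityʳ; -‿inverseˡ; -‿inverseʳ;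
           *-comm; *-assoc; *-identityˡ; *-identityʳ; zeroˡ; zeroʳ; distribˡ; distribʳ)
  module Solver = NaturalCoefficients (CommutativeRing.commutativeSemiring commutativeRing)
  open Solver using (solve; _:+_; _:=_)

  +-mono-≤ : ∀ {a b c d} → a ≤ b → c ≤ d → a + c ≤ b + d
  +-mono-≤ {a} {b} {c} {d} a≤b c≤d =
    ≤-trans (+-monoˡ-≤ c a≤b) (subst₂ _≤_ (+-comm c b) (+-comm d b) (+-monoˡ-≤ b c≤d))

  +-cancelʳ-≤ : ∀ {a b} c → a + c ≤ b + c → a ≤ b
  +-cancelʳ-≤ {a} {b} c le = subst₂ _≤_ (cancel a) (cancel b) (+-monoˡ-≤ (- c) le)
    where
    cancel : ∀ x → x + c + - c ≡ x
    cancel x = trans (+-assoc x c (- c)) (trans (cong (x +_) (-‿inverseʳ c)) (+-identityʳ x))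

  x≤x+y : ∀ {x y} → 0ℝ ≤ y → x ≤ x + y
  x≤x+y {x} {y} 0≤y = subst (_≤ x + y) (+-identityʳ x) (+-mono-≤ ≤-refl 0≤y)

  x≤y+x : ∀ {x y} → 0ℝ ≤ y → x ≤ y + x
  x≤y+x {x} {y} 0≤y = subst (x ≤_) (+-comm x y) (x≤x+y 0≤y)

  +-nonNegative : ∀ {x y} → 0ℝ ≤ x → 0ℝ ≤ y → 0ℝ ≤ x + y
  +-nonNegative 0≤x 0≤y = ≤-trans 0≤x (x≤x+y 0≤y)

  -- Stated without subtraction, so that the equation is a semiring identity.
  ≤-slack : ∀ {x y z} → 0ℝ ≤ z → x + z ≡ y → x ≤ y
  ≤-slack 0≤z refl = x≤x+y 0≤z

  slack : ∀ {x y} → x ≤ y → ∃ λ z → 0ℝ ≤ z × y ≡ x + z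
  slack {x} {y} x≤y = y - x , subst (_≤ y - x) (-‿inverseʳ x) (+-monoˡ-≤ (- x) x≤y) ,
    sym (trans (+-comm x (y - x))
      (trans (+-assoc y (- x) x) (trans (cong (y +_) (-‿inverseˡ x)) (+-identityʳ y))))

  *-monoˡ-≤ : ∀ {x y z} → 0ℝ ≤ z → x ≤ y → z * x ≤ z * y
  *-monoˡ-≤ {x} {_} {z} 0≤z x≤y with slack x≤y
  ... | s , 0≤s , refl = ≤-slack (*-nonNegative 0≤z 0≤s) (sym (distribˡ z x s))

  *-monoʳ-≤ : ∀ {x y z} → 0ℝ ≤ z → x ≤ y → x * z ≤ y * z
  *-monoʳ-≤ {x} {y} {z} 0≤z x≤y = subst₂ _≤_ (*-comm z x) (*-comm z y) (*-monoˡ-≤ 0≤z x≤y)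

  <⇒≤ : ∀ {x y} → x < y → x ≤ y
  <⇒≤ {x} {y} x<y with ≤-total x y
  ... | inj₁ x≤y = x≤y
  ... | inj₂ y≤x = contradiction y≤x x<y

  0≤1 : 0ℝ ≤ 1ℝ
  0≤1 with ≤-total 0ℝ 1ℝ
  ... | inj₁ 0≤1 = 0≤1
  ... | inj₂ 1≤0 = subst (0ℝ ≤_) square (*-nonNegative 0≤-1 0≤-1)
    where
    0≤-1 : 0ℝ ≤ - 1ℝ
    0≤-1 = subst₂ _≤_ (-‿inverseʳ 1ℝ) (+-identityˡ (- 1ℝ)) (+-monoˡ-≤ (- 1ℝ) 1≤0)
    open RingProperties (CommutativeRing.ring commutativeRing) using (-1*x≈-x; -‿involutive)
    square : - 1ℝ * - 1ℝ ≡ 1ℝ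
    square = trans (-1*x≈-x (- 1ℝ)) (-‿involutive 1ℝ)

  0<1 : 0ℝ < 1ℝ
  0<1 1≤0 = 0≢1 (≤-antisym 0≤1 1≤0)

  ⁻¹-nonNegative : ∀ {x} → 0ℝ < x → 0ℝ ≤ x ⁻¹
  ⁻¹-nonNegative {x} 0<x with ≤-total 0ℝ (x ⁻¹)
  ... | inj₁ 0≤x⁻¹ = 0≤x⁻¹
  ... | inj₂ x⁻¹≤0 = contradiction
    (subst₂ _≤_ (⁻¹-inverse x λ where refl → 0<x ≤-refl) (zeroʳ x) (*-monoˡ-≤ (<⇒≤ 0<x) x⁻¹≤0)) 0<1

  *-cancelˡ-≤ : ∀ {x y z} → 0ℝ < z → z * x ≤ z * y → x ≤ y
  *-cancelˡ-≤ {x} {y} {z} 0<z le = subst₂ _≤_ (cancel x) (cancel y) (*-monoˡ-≤ (⁻¹-nonNegative 0<z) le)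
    where
    cancel : ∀ w → z ⁻¹ * (z * w) ≡ w
    cancel w = trans (sym (*-assoc _ z w))
      (trans (cong (_* w) (trans (*-comm _ z) (⁻¹-inverse z λ where refl → 0<z ≤-refl))) (*-identityˡ w))

  0<-mono : ∀ {x y} → 0ℝ < x → x ≤ y → 0ℝ < y
  0<-mono 0<x x≤y y≤0 = 0<x (≤-trans x≤y y≤0)

  1-p+p≡1 : ∀ p → 1ℝ - p + p ≡ 1ℝ
  1-p+p≡1 p = trans (+-assoc 1ℝ (- p) p) (trans (cong (1ℝ +_) (-‿inverseˡ p)) (+-identityʳ 1ℝ))

  p+1-p≡1 : ∀ p → p + (1ℝ - p) ≡ 1ℝ
  p+1-p≡1 p = trans (+-comm p (1ℝ - p)) (1-p+p≡1 p)

  pow2 : ℕ → ℝ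
  pow2 zero    = 1ℝ
  pow2 (suc k) = pow2 k + pow2 k

  1≤pow2 : ∀ k → 1ℝ ≤ pow2 k
  1≤pow2 zero    = ≤-refl
  1≤pow2 (suc k) = ≤-trans (1≤pow2 k) (x≤x+y (≤-trans 0≤1 (1≤pow2 k)))

  0≤pow2 : ∀ k → 0ℝ ≤ pow2 k
  0≤pow2 k = ≤-trans 0≤1 (1≤pow2 k)

  pow2-+ : ∀ j k → pow2 (j ℕ.+ k) ≡ pow2 j * pow2 k
  pow2-+ zero    k = sym (*-identityˡ _)
  pow2-+ (suc j) k = trans (cong₂ _+_ (pow2-+ j k) (pow2-+ j k)) (sym (distribʳ _ (pow2 j) (pow2 j)))

  pow2-mono-≤ : ∀ {j k} → j ℕ.≤ k → pow2 j ≤ pow2 k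
  pow2-mono-≤ {j} {k} j≤k = subst (λ i → pow2 j ≤ pow2 i) (ℕₚ.m+[n∸m]≡n j≤k)
    (subst (pow2 j ≤_) (sym (pow2-+ j (k ℕ.∸ j)))
      (subst (_≤ pow2 j * pow2 (k ℕ.∸ j)) (*-identityʳ (pow2 j)) (*-monoˡ-≤ (0≤pow2 j) (1≤pow2 (k ℕ.∸ j)))))

  -- If σ is the supremum of the numbers c 2ᵏ, then σ − c 2ᵏ ≥ c 2ᵏ ≥ c for all
  -- k, so that σ − c is an upper bound.
  archimedean : ∀ {c b} → (∀ k → c * pow2 k ≤ b) → c ≤ 0ℝ
  archimedean {c} {b} bounded = decidable-stable (c ≤? 0ℝ) λ 0<c →
    let σ , σ-ub , σ-least = complete (λ x → ∃ λ k → x ≡ c * pow2 k) (_ , 0 , refl)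
                                (b , λ where _ (k , refl) → bounded k)
        step : ∀ k → c * pow2 k ≤ σ - c
        step k = +-cancelʳ-≤ c (≤-trans
          (+-mono-≤ ≤-refl (subst (_≤ c * pow2 k) (*-identityʳ c) (*-monoˡ-≤ (<⇒≤ 0<c) (1≤pow2 k))))
          (subst₂ _≤_ (distribˡ c (pow2 k) (pow2 k)) (sym (cancel σ)) (σ-ub _ (suc k , refl))))
        σ≤σ-c = σ-least (σ - c) λ where _ (k , refl) → step k
    in 0<c (+-cancelʳ-≤ σ (subst₂ _≤_ (+-comm σ c) (trans (cancel σ) (sym (+-identityˡ σ)))
      (+-monoˡ-≤ c σ≤σ-c)))
    where
    cancel : ∀ x → x - c + c ≡ x
    cancel x = trans (+-assoc x (- c) c) (trans (cong (x +_) (-‿inverseˡ c)) (+-identityʳ x))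

  ∑-mono : ∀ n {f g : ℕ → ℝ} → (∀ i → i ℕ.< n → f i ≤ g i) → ∑[ n ] f ≤ ∑[ n ] g
  ∑-mono zero    _   = ≤-refl
  ∑-mono (suc n) f≤g = +-mono-≤ (∑-mono n λ i i<n → f≤g i (ℕₚ.m<n⇒m<1+n i<n)) (f≤g n (ℕₚ.n<1+n n))

  ∑-zero : ∀ n → ∑[ n ] (λ _ → 0ℝ) ≡ 0ℝ
  ∑-zero zero    = refl
  ∑-zero (suc n) = trans (+-identityʳ _) (∑-zero n)

  ∑-nonNegative : ∀ n {f : ℕ → ℝ} → (∀ i → 0ℝ ≤ f i) → 0ℝ ≤ ∑[ n ] f
  ∑-nonNegative n 0≤f = subst (_≤ ∑[ n ] _) (∑-zero n) (∑-mono n λ i _ → 0≤f i)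

  ∑-+ : ∀ n (f g : ℕ → ℝ) → ∑[ n ] (λ i → f i + g i) ≡ ∑[ n ] f + ∑[ n ] g
  ∑-+ zero    f g = sym (+-identityʳ 0ℝ)
  ∑-+ (suc n) f g = trans (cong (_+ (f n + g n)) (∑-+ n f g))
    (solve 4 (λ a b c d → a :+ b :+ (c :+ d) := a :+ c :+ (b :+ d)) refl (∑[ n ] f) (∑[ n ] g) (f n) (g n))

  ∑-monoˡ : ∀ {m n} {f : ℕ → ℝ} → (∀ i → 0ℝ ≤ f i) → m ℕ.≤ n → ∑[ m ] f ≤ ∑[ n ] f
  ∑-monoˡ {m} {n} {f} 0≤f m≤n = go (ℕₚ.≤⇒≤′ m≤n)
    where
    go : ∀ {n} → m ℕ.≤′ n → ∑[ m ] f ≤ ∑[ n ] f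
    go (ℕ.≤′-reflexive refl) = ≤-refl
    go (ℕ.≤′-step m≤n) = ≤-trans (go m≤n) (x≤x+y (0≤f _))

-- Closed walks on a cycle and optimal tours.

module Tours (ℛ : RealNumbers) (Γ : Exploration.Cycle ℛ) where
  open RealNumbers ℛ
  open OrderedField ℛ
  open Solver using (solve; _:+_; _:=_)
  open Exploration ℛ
  open Cycle Γ

  pos : ℕ → Vertex
  pos i = i mod size

  w : ℕ → ℝ
  w i = weight (pos i)

  totalWeight pathWeight : ℝ
  totalWeight = ∑[ size ] w
  pathWeight  = ∑[ pred size ] w

  w≥0 : ∀ i → 0ℝ ≤ w i
  w≥0 i = weight≥0 (pos i)

  size≡suc-pred : size ≡ suc (pred size)
  size≡suc-pred = sym (ℕₚ.suc-pred size)

  toℕ-pos : ∀ {i} → i ℕ.< size → toℕ (pos i) ≡ i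
  toℕ-pos i<n = trans (toℕ-fromℕ< _) (m<n⇒m%n≡m i<n)

  pos-toℕ : ∀ v → pos (toℕ v) ≡ v
  pos-toℕ v = toℕ-injective (toℕ-pos (toℕ<n v))

  pos-cong-% : ∀ {i j} → i % size ≡ j % size → pos i ≡ pos j
  pos-cong-% eq = toℕ-injective (trans (toℕ-fromℕ< _) (trans eq (sym (toℕ-fromℕ< _))))

  pos-size : pos size ≡ pos 0
  pos-size = pos-cong-% (trans (n%n≡0 size) (sym (m<n⇒m%n≡m (ℕₚ.<-≤-trans ℕ.z<s 3≤size))))

  move-cw-pos : ∀ {i} → i ℕ.< size → move cw (pos i) ≡ pos (suc i)
  move-cw-pos i<n = cong (pos ∘ suc) (toℕ-pos i<n)

  move-ccw-pos : ∀ {i} → i ℕ.< size → move ccw (pos (suc i)) ≡ pos i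
  move-ccw-pos {i} i<n with ℕₚ.m≤n⇒m<n∨m≡n i<n
  ... | inj₁ 1+i<n = trans (cong (λ k → pos (k ℕ.+ pred size)) (toℕ-pos 1+i<n)) (pos-cong-%
    (trans (cong (_% size) (trans (sym (ℕₚ.+-suc i (pred size))) (cong (i ℕ.+_) (ℕₚ.suc-pred size))))
      ([m+n]%n≡m%n i size)))
  ... | inj₂ 1+i≡n = trans (cong (move ccw) (trans (cong pos 1+i≡n) pos-size))
    (trans (cong (λ k → pos (k ℕ.+ pred size)) (toℕ-pos (ℕₚ.<-≤-trans ℕ.z<s 3≤size)))
      (cong (pos ∘ pred) (sym 1+i≡n)))

  edgeIndex : Dir → Vertex → ℕ
  edgeIndex cw  v = toℕ v
  edgeIndex ccw v = toℕ (move ccw v)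

  edgeIndex<size : ∀ d v → edgeIndex d v ℕ.< size
  edgeIndex<size cw  v = toℕ<n v
  edgeIndex<size ccw v = toℕ<n (move ccw v)

  edge≡w : ∀ d v → edge d v ≡ w (edgeIndex d v)
  edge≡w cw  v = cong weight (sym (pos-toℕ v))
  edge≡w ccw v = cong weight (sym (pos-toℕ (move ccw v)))

  edge≥0 : ∀ d v → 0ℝ ≤ edge d v
  edge≥0 cw  v = weight≥0 v
  edge≥0 ccw v = weight≥0 (move ccw v)

  walkLength≥0 : ∀ v ds → 0ℝ ≤ walkLength v ds
  walkLength≥0 v []       = ≤-refl
  walkLength≥0 v (d ∷ ds) = +-nonNegative (edge≥0 d v) (walkLength≥0 (move d v) ds)

  edgeEnds : ∀ d v → let i = edgeIndex d v in
             (v ≡ pos i × move d v ≡ pos (suc i)) ⊎ (v ≡ pos (suc i) × move d v ≡ pos i)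
  edgeEnds cw  v = inj₁ (sym (pos-toℕ v) , refl)
  edgeEnds ccw v = inj₂ (sym cw∘ccw , sym (pos-toℕ (move ccw v)))
    where
    cw∘ccw : move cw (move ccw v) ≡ v
    cw∘ccw with toℕ v in eq
    ... | suc i = trans (cong (move cw)
      (trans (cong (pos) (cong (ℕ._+ pred size) (sym eq))) (trans (cong (move ccw) v≡) (move-ccw-pos i<n))))
        (trans (move-cw-pos i<n) (sym v≡))
      where
      v≡ : v ≡ pos (suc i)
      v≡ = trans (sym (pos-toℕ v)) (cong pos eq)
      i<n : i ℕ.< size
      i<n = ℕₚ.<-trans (ℕₚ.n<1+n i) (subst (ℕ._< size) eq (toℕ<n v))
    ... | zero = trans (move-cw-pos (ℕₚ.≤-reflexive (ℕₚ.suc-pred size)))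
      (trans (cong pos (ℕₚ.suc-pred size)) (trans pos-size (trans (cong pos (sym eq)) (pos-toℕ v))))

  indicator : {A : Set} → Dec A → ℝ → ℝ
  indicator (yes _) x = x
  indicator (no  _) x = 0ℝ

  indicator≥0 : {A : Set} (A? : Dec A) {x : ℝ} → 0ℝ ≤ x → 0ℝ ≤ indicator A? x
  indicator≥0 (yes _) 0≤x = 0≤x
  indicator≥0 (no  _) _   = ≤-refl

  indicator-yes : {A : Set} (A? : Dec A) {x : ℝ} → A → indicator A? x ≡ x
  indicator-yes (yes _) _ = refl
  indicator-yes (no ¬a) a = contradiction a ¬a

  ∑-indicator-≥ : ∀ n j (f : ℕ → ℝ) → n ℕ.≤ j → ∑[ n ] (λ i → indicator (j ℕₚ.≟ i) (f i)) ≡ 0ℝ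
  ∑-indicator-≥ zero    j f _ = refl
  ∑-indicator-≥ (suc n) j f n<j with j ℕₚ.≟ n
  ... | yes refl = contradiction n<j (ℕₚ.n≮n n)
  ... | no _     = trans (+-identityʳ _) (∑-indicator-≥ n j f (ℕₚ.<⇒≤ n<j))

  ∑-indicator : ∀ n {j} (f : ℕ → ℝ) → j ℕ.< n → ∑[ n ] (λ i → indicator (j ℕₚ.≟ i) (f i)) ≡ f j
  ∑-indicator (suc n) {j} f j<1+n with j ℕₚ.≟ n
  ... | yes refl = trans (cong (_+ f j) (∑-indicator-≥ n j f ℕₚ.≤-refl)) (+-identityˡ (f j))
  ... | no j≢n   = trans (+-identityʳ _) (∑-indicator n f (ℕₚ.≤∧≢⇒< (ℕ.s≤s⁻¹ j<1+n) j≢n))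

  -- The length that the walk spends on edge `i`, one `w i` per traversal. Recording lengths instead
  -- of counts makes the sum over all edges the length of the walk.
  use : ℕ → Vertex → List Dir → ℝ
  use i v []       = 0ℝ
  use i v (d ∷ ds) = indicator (edgeIndex d v ℕₚ.≟ i) (w i) + use i (move d v) ds

  use≥0 : ∀ i v ds → 0ℝ ≤ use i v ds
  use≥0 i v []       = ≤-refl
  use≥0 i v (d ∷ ds) = +-nonNegative (indicator≥0 (edgeIndex d v ℕₚ.≟ i) (w≥0 i)) (use≥0 i (move d v) ds)

  ∑-use : ∀ v ds → ∑[ size ] (λ i → use i v ds) ≡ walkLength v ds
  ∑-use v []       = ∑-zero size
  ∑-use v (d ∷ ds) = trans (∑-+ size _ _)
    (cong₂ _+_ (trans (∑-indicator size w (edgeIndex<size d v)) (sym (edge≡w d v))) (∑-use (move d v) ds))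

  Crossed : ℕ → Vertex → List Dir → Set
  Crossed i v []       = ⊥
  Crossed i v (d ∷ ds) = edgeIndex d v ≡ i ⊎ Crossed i (move d v) ds

  crossed? : ∀ i v ds → Dec (Crossed i v ds)
  crossed? i v []       = no λ ()
  crossed? i v (d ∷ ds) = edgeIndex d v ℕₚ.≟ i ⊎-dec crossed? i (move d v) ds

  crossed⇒w≤use : ∀ {i} v ds → Crossed i v ds → w i ≤ use i v ds
  crossed⇒w≤use {i} v (d ∷ ds) (inj₁ eq) =
    subst (λ x → w i ≤ x + use i (move d v) ds) (sym (indicator-yes (_ ℕₚ.≟ _) eq))
      (x≤x+y (use≥0 i (move d v) ds))
  crossed⇒w≤use {i} v (d ∷ ds) (inj₂ c) =
    ≤-trans (crossed⇒w≤use (move d v) ds c) (x≤y+x (indicator≥0 (edgeIndex d v ℕₚ.≟ i) (w≥0 i)))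

  -- Removing the edges e and f leaves two arcs; a colouring of the vertices that
  -- distinguishes them changes only along e and f.
  module TwoArcs {e f : ℕ} (colour : Vertex → Bool)
    (constant : ∀ i → i ℕ.< size → i ≢ e → i ≢ f → colour (pos i) ≡ colour (pos (suc i))) where

    colour-step : ∀ d v → edgeIndex d v ≢ e → edgeIndex d v ≢ f → colour v ≡ colour (move d v)
    colour-step d v ≢e ≢f with edgeEnds d v
    ... | inj₁ (v≡ , m≡) = trans (cong colour v≡)
      (trans (constant _ (edgeIndex<size d v) ≢e ≢f) (cong colour (sym m≡)))
    ... | inj₂ (v≡ , m≡) = trans (cong colour v≡)
      (trans (sym (constant _ (edgeIndex<size d v) ≢e ≢f)) (cong colour (sym m≡)))

    crosses-once : ∀ v ds → ¬ Crossed e v ds → colour v ≢ colour (walkEnd v ds) → Crossed f v ds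
    crosses-once v []       ¬e ≢ = contradiction refl ≢
    crosses-once v (d ∷ ds) ¬e ≢ with edgeIndex d v ℕₚ.≟ f
    ... | yes eq = inj₁ eq
    ... | no ≢f  = inj₂ (crosses-once (move d v) ds (¬e ∘ inj₂)
      (subst (_≢ colour (walkEnd v (d ∷ ds))) (colour-step d v (¬e ∘ inj₁) ≢f) ≢))

    -- The walk has to leave the colour class of `v` to reach `u` and has to return to it. Without
    -- `e`, both changes of colour happen along `f`.
    crosses-twice : ∀ v ds → ¬ Crossed e v ds → ∀ {u} → u ∈ walkVertices v ds → colour v ≢ colour u →
                    colour v ≡ colour (walkEnd v ds) → w f + w f ≤ use f v ds
    crosses-twice v []       ¬e (here refl) ≢u ≡end = contradiction refl ≢u
    crosses-twice v (d ∷ ds) ¬e (here refl) ≢u ≡end = contradiction refl ≢u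
    crosses-twice v (d ∷ ds) ¬e {u} (there u∈) ≢u ≡end with colour v Bool.≟ colour (move d v)
    ... | yes same = ≤-trans
      (crosses-twice (move d v) ds (¬e ∘ inj₂) u∈ (subst (_≢ colour u) same ≢u) (trans (sym same) ≡end))
      (x≤y+x (indicator≥0 (edgeIndex d v ℕₚ.≟ f) (w≥0 f)))
    ... | no differ = +-mono-≤
      (≤-reflexive (sym (indicator-yes (edgeIndex d v ℕₚ.≟ f)
        (decidable-stable (edgeIndex d v ℕₚ.≟ f) λ ≢f → differ (colour-step d v (¬e ∘ inj₁) ≢f)))))
      (crossed⇒w≤use (move d v) ds (crosses-once (move d v) ds (¬e ∘ inj₂) λ eq → differ (trans ≡end (sym eq))))

    tour-crosses-twice : ∀ {v ds} → IsTour v ds → ¬ Crossed e v ds → ∀ x y → colour x ≢ colour y → w f + w f ≤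
      use f v ds
    tour-crosses-twice {v} {ds} (closed , visits) ¬e x y x≢y with colour v Bool.≟ colour x
    ... | no v≢x  = crosses-twice v ds ¬e (visits x) v≢x (cong colour (sym closed))
    ... | yes v≡x = crosses-twice v ds ¬e (visits y) (λ v≡y → x≢y (trans (sym v≡x) v≡y))
      (cong colour (sym closed))

  between? : ∀ l r x → Dec (l ℕ.< x × x ℕ.≤ r)
  between? l r x = l ℕₚ.<? x ×-dec x ℕₚ.≤? r

  -- Edge `i` joins positions `i` and `i + 1`, so removing the edges `l < r` leaves the positions in
  -- `(l, r]` and their complement.
  arc : ℕ → ℕ → Vertex → Bool
  arc l r v = does (between? l r (toℕ v))

  arc-constant : ∀ l r → r ℕ.< size → ∀ i → i ℕ.< size → i ≢ l → i ≢ r → arc l r (pos i) ≡ arc l r (pos (suc i))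
  arc-constant l r r<n i i<n i≢l i≢r with ℕₚ.m≤n⇒m<n∨m≡n i<n
  ... | inj₁ 1+i<n rewrite toℕ-pos i<n | toℕ-pos 1+i<n = does-⇔
    (mk⇔ (λ (l<i , i≤r) → ℕₚ.m<n⇒m<1+n l<i , ℕₚ.≤∧≢⇒< i≤r i≢r)
         (λ (l<1+i , i<r) → ℕₚ.≤∧≢⇒< (ℕ.s≤s⁻¹ l<1+i) (i≢l ∘ sym) , ℕₚ.<⇒≤ i<r))
    (between? l r i) (between? l r (suc i))
  -- The edge from the last position back to position 0: neither end lies in the arc, since `i ≤ r`
  -- would force `i ≡ r`.
  ... | inj₂ 1+i≡n rewrite toℕ-pos i<n | trans (cong toℕ (trans (cong pos 1+i≡n) pos-size))
    (toℕ-pos (ℕₚ.<-≤-trans ℕ.z<s 3≤size)) = does-⇔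
    (mk⇔ (λ (_ , i≤r) → contradiction
      (ℕₚ.≤-antisym i≤r (ℕ.s≤s⁻¹ (subst (suc r ℕ.≤_) (sym 1+i≡n) r<n))) i≢r) λ ())
    (between? l r i) (between? l r 0)

  arc-distinguishes : ∀ {l r} → l ℕ.< r → r ℕ.< size → arc l r (pos r) ≢ arc l r (pos l)
  arc-distinguishes {l} {r} l<r r<n
    rewrite toℕ-pos r<n | toℕ-pos (ℕₚ.<-trans l<r r<n)
          | dec-true (between? l r r) (l<r , ℕₚ.≤-refl)
          | dec-false (between? l r l) (λ (l<l , _) → ℕₚ.n≮n l l<l) = λ ()

  tour-uses-twice : ∀ {v ds e f} → IsTour v ds → ¬ Crossed e v ds → e ≢ f → e ℕ.< size → f ℕ.< size →
    w f + w f ≤ use f v ds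
  tour-uses-twice {e = e} {f} tour ¬e e≢f e<n f<n with ℕₚ.<-cmp e f
  ... | tri< e<f _ _ = TwoArcs.tour-crosses-twice (arc e f) (arc-constant e f f<n) tour ¬e (pos f) (pos e)
    (arc-distinguishes e<f f<n)
  ... | tri≈ _ e≡f _ = contradiction e≡f e≢f
  ... | tri> _ _ f<e = TwoArcs.tour-crosses-twice (arc f e)
    (λ i i<n i≢e i≢f → arc-constant f e e<n i i<n i≢f i≢e) tour ¬e (pos e) (pos f) (arc-distinguishes f<e e<n)

  -- Either every edge is crossed, or some `e` is not and then all others are crossed twice. The
  -- second bound moves the subtraction of `2 w e` to the other side.
  tour-length : ∀ {v ds} → IsTour v ds → totalWeight ≤ walkLength v ds ⊎
    ∃ λ e → e ℕ.< size × totalWeight + totalWeight ≤ walkLength v ds + (w e + w e)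
  tour-length {v} {ds} tour with ℕₚ.anyUpTo? (λ i → ¬? (crossed? i v ds)) size
  ... | no all-crossed = inj₁ (subst (totalWeight ≤_) (∑-use v ds) (∑-mono size λ i i<n →
    crossed⇒w≤use v ds (decidable-stable (crossed? i v ds) λ ¬c → all-crossed (i , i<n , ¬c))))
  ... | yes (e , e<n , ¬e) = inj₂ (e , e<n , subst₂ _≤_ (∑-+ size w w)
    (trans (∑-+ size _ _) (cong₂ _+_ (∑-use v ds) (∑-indicator size (λ i → w i + w i) e<n)))
    (∑-mono size bound))
    where
    bound : ∀ i → i ℕ.< size → w i + w i ≤ use i v ds + indicator (e ℕₚ.≟ i) (w i + w i)
    bound i i<n with e ℕₚ.≟ i
    ... | yes refl = x≤y+x (use≥0 i v ds)
    ... | no e≢i   = ≤-trans (tour-uses-twice tour ¬e e≢i e<n i<n) (x≤x+y ≤-refl)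

  walkEnd-++ : ∀ v ds es → walkEnd v (ds ++ es) ≡ walkEnd (walkEnd v ds) es
  walkEnd-++ v []       es = refl
  walkEnd-++ v (d ∷ ds) es = walkEnd-++ (move d v) ds es

  walkLength-++ : ∀ v ds es → walkLength v (ds ++ es) ≡ walkLength v ds + walkLength (walkEnd v ds) es
  walkLength-++ v []       es = sym (+-identityˡ _)
  walkLength-++ v (d ∷ ds) es = trans (cong (edge d v +_) (walkLength-++ (move d v) ds es))
    (sym (+-assoc _ _ _))

  walkVertices-++ : ∀ v ds es {u} → u ∈ walkVertices v ds → u ∈ walkVertices v (ds ++ es)
  walkVertices-++ v []       []       u∈          = u∈
  walkVertices-++ v []       (e ∷ es) (here refl) = here refl
  walkVertices-++ v (d ∷ ds) es       (here refl) = here refl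
  walkVertices-++ v (d ∷ ds) es       (there u∈)  = there (walkVertices-++ (move d v) ds es u∈)

  cw-end : ∀ k i → i ℕ.+ k ℕ.≤ size → walkEnd (pos i) (replicate k cw) ≡ pos (i ℕ.+ k)
  cw-end zero    i _ = cong pos (sym (ℕₚ.+-identityʳ i))
  cw-end (suc k) i le rewrite ℕₚ.+-suc i k =
    trans (cong (λ v → walkEnd v (replicate k cw)) (move-cw-pos (ℕₚ.≤-trans (ℕ.s≤s (ℕₚ.m≤m+n i k)) le)))
      (cw-end k (suc i) le)

  -- The prefix sum up to `i` permits induction on `k` with a moving starting point and without
  -- subtraction.
  cw-length : ∀ k i → i ℕ.+ k ℕ.≤ size → ∑[ i ] w + walkLength (pos i) (replicate k cw) ≡ ∑[ i ℕ.+ k ] w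
  cw-length zero    i _ = trans (+-identityʳ _) (cong (λ j → ∑[ j ] w) (sym (ℕₚ.+-identityʳ i)))
  cw-length (suc k) i le rewrite ℕₚ.+-suc i k =
    trans (sym (+-assoc _ _ _))
      (trans (cong (λ v → ∑[ suc i ] w + walkLength v (replicate k cw))
        (move-cw-pos (ℕₚ.≤-trans (ℕ.s≤s (ℕₚ.m≤m+n i k)) le)))
        (cw-length k (suc i) le))

  cw-visits : ∀ k i j → i ℕ.+ k ℕ.≤ size → j ℕ.≤ k → pos (i ℕ.+ j) ∈ walkVertices (pos i) (replicate k cw)
  cw-visits zero    i zero    _  _ = here (cong pos (ℕₚ.+-identityʳ i))
  cw-visits (suc k) i zero    _  _ = here (cong pos (ℕₚ.+-identityʳ i))
  cw-visits (suc k) i (suc j) le (s≤s j≤k) rewrite ℕₚ.+-suc i k | ℕₚ.+-suc i j =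
    there (subst (λ v → pos (suc i ℕ.+ j) ∈ walkVertices v (replicate k cw))
      (sym (move-cw-pos (ℕₚ.≤-trans (ℕ.s≤s (ℕₚ.m≤m+n i k)) le))) (cw-visits k (suc i) j le j≤k))

  ccw-end : ∀ k → k ℕ.≤ size → walkEnd (pos k) (replicate k ccw) ≡ pos 0
  ccw-end zero    _  = refl
  ccw-end (suc k) k<n = trans (cong (λ v → walkEnd v (replicate k ccw)) (move-ccw-pos k<n))
    (ccw-end k (ℕₚ.<⇒≤ k<n))

  ccw-length : ∀ k → k ℕ.≤ size → walkLength (pos k) (replicate k ccw) ≡ ∑[ k ] w
  ccw-length zero    _   = refl
  ccw-length (suc k) k<n = trans (cong₂ _+_ (cong weight (move-ccw-pos k<n))
    (trans (cong (λ v → walkLength v (replicate k ccw)) (move-ccw-pos k<n)) (ccw-length k (ℕₚ.<⇒≤ k<n))))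
      (+-comm _ _)

  cw-visits-all : ∀ {k} → pred size ℕ.≤ k → k ℕ.≤ size → ∀ u → u ∈ walkVertices (pos 0) (replicate k cw)
  cw-visits-all p≤k k≤n u = subst (_∈ _) (pos-toℕ u)
    (cw-visits _ 0 (toℕ u) k≤n (ℕₚ.≤-trans (ℕₚ.<⇒≤pred (toℕ<n u)) p≤k))

  -- The round trip attains this length. A tour that misses `e` costs at least twice
  -- `totalWeight - w e`, which is no less since `w e` is at most half of the total.
  totalWeight-isOpt : (∀ i → i ℕ.< size → w i + w i ≤ totalWeight) → IsOpt totalWeight
  totalWeight-isOpt light =
    (pos 0 , replicate size cw ,
      (trans (cw-end size 0 ℕₚ.≤-refl) pos-size , cw-visits-all (ℕₚ.pred[n]≤n) ℕₚ.≤-refl) ,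
      trans (sym (+-identityˡ _)) (cw-length size 0 ℕₚ.≤-refl)) ,
    λ v ds tour → minimal (tour-length tour)
    where
    minimal : ∀ {x} → totalWeight ≤ x ⊎ (∃ λ e → e ℕ.< size × totalWeight + totalWeight ≤ x + (w e + w e)) →
      totalWeight ≤ x
    minimal (inj₁ T≤x)              = T≤x
    minimal (inj₂ (e , e<n , 2T≤x)) = +-cancelʳ-≤ totalWeight (≤-trans 2T≤x (+-mono-≤ ≤-refl (light e e<n)))

  -- The optimal tour avoids the edge between the last and the first position.
  pathWeight-isOpt : pathWeight ≤ w (pred size) → IsOpt (pathWeight + pathWeight)
  pathWeight-isOpt heavy =
    (pos 0 , replicate p cw ++ replicate p ccw ,
      (trans (walkEnd-++ (pos 0) (replicate p cw) _)
        (trans (cong (λ v → walkEnd v (replicate p ccw)) (cw-end p 0 p≤n)) (ccw-end p p≤n)) ,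
       λ u → walkVertices-++ (pos 0) (replicate p cw) _ (cw-visits-all ℕₚ.≤-refl p≤n u)) ,
      trans (walkLength-++ (pos 0) (replicate p cw) _) (cong₂ _+_
        (trans (sym (+-identityˡ _)) (cw-length p 0 p≤n))
        (trans (cong (λ v → walkLength v (replicate p ccw)) (cw-end p 0 p≤n)) (ccw-length p p≤n)))) ,
    λ v ds tour → minimal (tour-length tour)
    where
    p = pred size
    p≤n = ℕₚ.pred[n]≤n {size}
    total≡ : totalWeight ≡ pathWeight + w p
    total≡ = cong (λ n → ∑[ n ] w) size≡suc-pred
    -- An edge other than the last is part of the path, hence no heavier than the path and so no
    -- heavier than the last edge.
    w≤wp : ∀ e → e ℕ.< size → w e ≤ w p
    w≤wp e e<n with ℕₚ.m≤n⇒m<n∨m≡n (ℕₚ.<⇒≤pred e<n)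
    ... | inj₂ refl = ≤-refl
    ... | inj₁ e<p  = ≤-trans (x≤y+x (∑-nonNegative e w≥0)) (≤-trans (∑-monoˡ {suc e} w≥0 e<p) heavy)
    minimal : ∀ {x} → totalWeight ≤ x ⊎ (∃ λ e → e ℕ.< size × totalWeight + totalWeight ≤ x + (w e + w e)) →
      pathWeight + pathWeight ≤ x
    minimal (inj₁ T≤x) = ≤-trans (+-mono-≤ ≤-refl heavy) (subst (_≤ _) total≡ T≤x)
    minimal {x} (inj₂ (e , e<n , 2T≤x)) = +-cancelʳ-≤ (w p + w p) (≤-trans
      (subst (_≤ x + (w e + w e)) (trans (cong₂ _+_ total≡ total≡)
        (solve 2 (λ a b → a :+ b :+ (a :+ b) := a :+ a :+ (b :+ b)) refl pathWeight (w p))) 2T≤x)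
      (+-mono-≤ ≤-refl (+-mono-≤ (w≤wp e e<n) (w≤wp e e<n))))

-- Lower bounds for the expected cost, built up along the tree of trajectories.

module Guarantees (ℛ : RealNumbers) (A : Exploration.Algorithm ℛ) (Γ : Exploration.Cycle ℛ)
                  (s : Exploration.Cycle.Vertex Γ) where
  open RealNumbers ℛ
  open OrderedField ℛ
  open Solver using (solve; _:+_; _:*_; _:=_)
  open Exploration ℛ
  open Algorithm A
  open Cycle Γ
  open Tours ℛ Γ using (edge≥0; walkLength≥0)
  open Execution A Γ s public

  1-p≥0 : ∀ {p} → p ≤ 1ℝ → 0ℝ ≤ 1ℝ - p
  1-p≥0 {p} p≤1 = subst (_≤ 1ℝ - p) (-‿inverseʳ p) (+-monoˡ-≤ (- p) p≤1)

  stepProb≥0 : ∀ τ d → 0ℝ ≤ stepProb τ d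
  stepProb≥0 [] d with toward s lo | d
  ... | cw  | cw  = proj₁ (first-prob (viewAt s))
  ... | cw  | ccw = 1-p≥0 (proj₂ (first-prob (viewAt s)))
  ... | ccw | cw  = 1-p≥0 (proj₂ (first-prob (viewAt s)))
  ... | ccw | ccw = proj₁ (first-prob (viewAt s))
  stepProb≥0 (cw  ∷ τ) cw  = proj₁ (direct-prob (history (cw ∷ τ)))
  stepProb≥0 (cw  ∷ τ) ccw = 1-p≥0 (proj₂ (direct-prob (history (cw ∷ τ))))
  stepProb≥0 (ccw ∷ τ) cw  = 1-p≥0 (proj₂ (direct-prob (history (ccw ∷ τ))))
  stepProb≥0 (ccw ∷ τ) ccw = proj₁ (direct-prob (history (ccw ∷ τ)))

  stepProb-total : ∀ τ → stepProb τ cw + stepProb τ ccw ≡ 1ℝ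
  stepProb-total [] with toward s lo
  ... | cw  = trans (+-comm _ _) (1-p+p≡1 _)
  ... | ccw = 1-p+p≡1 _
  stepProb-total (cw  ∷ τ) = trans (+-comm _ _) (1-p+p≡1 _)
  stepProb-total (ccw ∷ τ) = 1-p+p≡1 _

  -- The first argument is the direction in which `lo` leads; the second is the direction wanted.
  portToward : Dir → Dir → Port
  portToward cw  cw  = lo
  portToward cw  ccw = hi
  portToward ccw cw  = hi
  portToward ccw ccw = lo

  stepProb-first : ∀ d → stepProb [] d ≡ portProb (portToward (toward s lo) d)
  stepProb-first d with toward s lo | d
  ... | cw  | cw  = refl
  ... | cw  | ccw = refl
  ... | ccw | cw  = refl
  ... | ccw | ccw = refl

  reachProb≥0 : ∀ τ → 0ℝ ≤ reachProb τ
  reachProb≥0 []      = 0≤1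
  reachProb≥0 (d ∷ τ) = *-nonNegative (reachProb≥0 τ) (stepProb≥0 τ d)

  arm≥0 : ∀ d k → 0ℝ ≤ arm d k
  arm≥0 d k = ∑-nonNegative k λ i → edge≥0 d (at d i)

  stepCost≥0 : ∀ τ d → 0ℝ ≤ stepCost τ d
  stepCost≥0 []        d   = edge≥0 d s
  stepCost≥0 (cw  ∷ τ) cw  = edge≥0 cw _
  stepCost≥0 (cw  ∷ τ) ccw = +-nonNegative (arm≥0 cw (explored cw (cw ∷ τ)))
    (arm≥0 ccw (suc (explored ccw (cw ∷ τ))))
  stepCost≥0 (ccw ∷ τ) cw  = +-nonNegative (arm≥0 ccw (explored ccw (ccw ∷ τ)))
    (arm≥0 cw (suc (explored cw (ccw ∷ τ))))
  stepCost≥0 (ccw ∷ τ) ccw = edge≥0 ccw _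

  explorationCost≥0 : ∀ τ → 0ℝ ≤ explorationCost τ
  explorationCost≥0 []      = ≤-refl
  explorationCost≥0 (d ∷ τ) = +-nonNegative (explorationCost≥0 τ) (stepCost≥0 τ d)

  leafCost : Trajectory → ℕ → ℝ
  leafCost τ N = reachProb τ * ∑[ N ] λ k → returnProb τ k * (explorationCost τ + returnCost τ k)

  -- The part of the truncated cost due to the m-step extensions of τ.
  extensionCost : ℕ → Trajectory → ℕ → ℝ
  extensionCost zero    τ N = leafCost τ N
  extensionCost (suc m) τ N = extensionCost m (cw ∷ τ) N + extensionCost m (ccw ∷ τ) N

  Nondecreasing : (ℕ → ℝ) → Set
  Nondecreasing L = ∀ {M N} → M ℕ.≤ N → L M ≤ L N

  leafTerm≥0 : ∀ τ k → 0ℝ ≤ returnProb τ k * (explorationCost τ + returnCost τ k)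
  leafTerm≥0 τ k = *-nonNegative (Lottery.prob≥0 (return (history τ)) k)
    (+-nonNegative (explorationCost≥0 τ)
      (walkLength≥0 (current τ) (directions (current τ) (Lottery.outcome (return (history τ)) k))))

  extensionCost-nondecreasing : ∀ m τ → Nondecreasing (extensionCost m τ)
  extensionCost-nondecreasing zero    τ M≤N = *-monoˡ-≤ (reachProb≥0 τ) (∑-monoˡ (leafTerm≥0 τ) M≤N)
  extensionCost-nondecreasing (suc m) τ M≤N =
    +-mono-≤ (extensionCost-nondecreasing m (cw ∷ τ) M≤N) (extensionCost-nondecreasing m (ccw ∷ τ) M≤N)

  extensionCost≥0 : ∀ m τ N → 0ℝ ≤ extensionCost m τ N
  extensionCost≥0 zero    τ N = *-nonNegative (reachProb≥0 τ) (∑-nonNegative N (leafTerm≥0 τ))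
  extensionCost≥0 (suc m) τ N = +-nonNegative (extensionCost≥0 m (cw ∷ τ) N) (extensionCost≥0 m (ccw ∷ τ) N)

  sumTrajectories-extensionCost : ∀ m j N → sumTrajectories m (λ τ → extensionCost j τ N) ≡ extensionCost
    (m ℕ.+ j) [] N
  sumTrajectories-extensionCost zero    j N = refl
  sumTrajectories-extensionCost (suc m) j N =
    trans (sumTrajectories-extensionCost m (suc j) N) (cong (λ k → extensionCost k [] N) (ℕₚ.+-suc m j))

  truncatedCost≡extensionCost : ∀ N → truncatedCost N ≡ extensionCost steps [] N
  truncatedCost≡extensionCost N =
    trans (sumTrajectories-extensionCost steps 0 N) (cong (λ k → extensionCost k [] N) (ℕₚ.+-identityʳ steps))

  infix 4 _≲_ _⊩_

  -- x is at most the supremum of the sequence L.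
  _≲_ : ℝ → (ℕ → ℝ) → Set
  x ≲ L = ∀ z → (∀ N → L N ≤ z) → x ≤ z

  -- One truncation must serve both sequences: by monotonicity, `K M + L N` is bounded by the value
  -- at the larger of `M` and `N`. Hence first `x` is bounded with `N` fixed, then `y`.
  ≲-+ : ∀ {x y K L} → Nondecreasing K → Nondecreasing L → x ≲ K → y ≲ L → x + y ≲ (λ N → K N + L N)
  ≲-+ {x} {y} {K} {L} K↗ L↗ x≲K y≲L z bound = transpose′ (y≲L (z - x) λ N →
    transpose (transpose′ (x≲K (z - L N) λ M → transpose
      (≤-trans (+-mono-≤ (K↗ (ℕₚ.m≤m⊔n M N)) (L↗ (ℕₚ.m≤n⊔m M N))) (bound (M ℕ.⊔ N))))))
    where
    cancel : ∀ a b → a - b + b ≡ a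
    cancel a b = trans (+-assoc a (- b) b) (trans (cong (a +_) (-‿inverseˡ b)) (+-identityʳ a))
    transpose : ∀ {a b} → a + b ≤ z → a ≤ z - b
    transpose {a} {b} le = +-cancelʳ-≤ b (subst (a + b ≤_) (sym (cancel z b)) le)
    transpose′ : ∀ {a b} → a ≤ z - b → b + a ≤ z
    transpose′ {a} {b} le = subst₂ _≤_ (+-comm a b) (cancel z b) (+-monoˡ-≤ b le)

  -- Conditional on the trajectory starting with τ, the expected total cost is
  -- at least x.
  _⊩_ : Trajectory → ℝ → Set
  τ ⊩ x = ∀ m → m ℕ.+ length τ ≡ steps → reachProb τ * x ≲ extensionCost m τ

  ⊩-weaken : ∀ {τ x y} → y ≤ x → τ ⊩ x → τ ⊩ y
  ⊩-weaken {τ} y≤x τ⊩x m eq z bound = ≤-trans (*-monoˡ-≤ (reachProb≥0 τ) y≤x) (τ⊩x m eq z bound)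

  ⊩-unreachable : ∀ {τ x} → reachProb τ ≡ 0ℝ → τ ⊩ x
  ⊩-unreachable {τ} {x} r≡0 m _ z bound =
    subst (_≤ z) (sym (trans (cong (_* x) r≡0) (zeroˡ x))) (≤-trans (extensionCost≥0 m τ 0) (bound 0))

  branch : ∀ {τ x y} m → reachProb (cw ∷ τ) * x ≲ extensionCost m (cw ∷ τ) → reachProb
    (ccw ∷ τ) * y ≲ extensionCost m (ccw ∷ τ) →
           reachProb τ * (stepProb τ cw * x + stepProb τ ccw * y) ≲ extensionCost (suc m) τ
  branch {τ} {x} {y} m left right z bound = subst (_≤ z)
    (solve 5 (λ r p q x y → r :* p :* x :+ r :* q :* y := r :* (p :* x :+ q :* y)) refl (reachProb τ)
      (stepProb τ cw) (stepProb τ ccw) x y)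
    (≲-+ (extensionCost-nondecreasing m (cw ∷ τ)) (extensionCost-nondecreasing m (ccw ∷ τ)) left right z bound)

  ⊩-branch : ∀ {τ x y} → length τ ℕ.< steps → cw ∷ τ ⊩ x → ccw ∷ τ ⊩ y →
    τ ⊩ stepProb τ cw * x + stepProb τ ccw * y
  ⊩-branch     τ<steps _    _     zero    eq = contradiction τ<steps (ℕₚ.<-irrefl eq)
  ⊩-branch {τ} _       left right (suc m) eq = branch m (left m eq′) (right m eq′)
    where eq′ = trans (ℕₚ.+-suc m (length τ)) eq

  average : ∀ τ x → stepProb τ cw * x + stepProb τ ccw * x ≡ x
  average τ x = trans (sym (distribʳ x (stepProb τ cw) (stepProb τ ccw)))
    (trans (cong (_* x) (stepProb-total τ)) (*-identityˡ x))

  -- The return probabilities have total 1 only as a supremum. Each of their partial sums is at most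
  -- `z / (reachProb τ * x)`, hence so is 1; if the divisor is not positive, the claim is trivial.
  leaf : ∀ τ x → length τ ≡ steps → 0ℝ ≤ x →
         (∀ ds → walkEnd (current τ) ds ≡ s → x ≤ explorationCost τ + walkLength (current τ) ds) →
           reachProb τ * x ≲ leafCost τ
  leaf τ x len 0≤x ret z bound with reachProb τ * x ≤? 0ℝ
  ... | yes r≤0 = ≤-trans r≤0 (≤-trans (extensionCost≥0 0 τ 0) (bound 0))
  ... | no 0<r  = subst (_≤ z) (*-identityʳ (reachProb τ * x))
    (subst (reachProb τ * x * 1ℝ ≤_) div (*-monoˡ-≤ (<⇒≤ 0<r)
      (proj₂ (Lottery.total lottery) (z * (reachProb τ * x) ⁻¹) λ where
        _ (N , refl) → *-cancelˡ-≤ 0<r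
          (subst (reachProb τ * x * ∑[ N ] returnProb τ ≤_) (sym div) (scaled N)))))
    where
    lottery = return (history τ)
    div : reachProb τ * x * (z * (reachProb τ * x) ⁻¹) ≡ z
    div = trans (solve 3 (λ a b c → a :* (b :* c) := b :* (a :* c)) refl (reachProb τ * x) z
      ((reachProb τ * x) ⁻¹))
      (trans (cong (z *_) (⁻¹-inverse _ λ eq → 0<r (≤-reflexive eq))) (*-identityʳ z))
    ∑-*ʳ : ∀ N → ∑[ N ] (λ k → returnProb τ k * x) ≡ ∑[ N ] returnProb τ * x
    ∑-*ʳ zero    = sym (zeroˡ x)
    ∑-*ʳ (suc N) = trans (cong (_+ returnProb τ N * x) (∑-*ʳ N)) (sym (distribʳ x _ _))
    scaled : ∀ N → reachProb τ * x * ∑[ N ] returnProb τ ≤ z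
    scaled N = subst (_≤ z) (trans (cong (reachProb τ *_) (∑-*ʳ N))
        (solve 3 (λ r p x → r :* (p :* x) := r :* x :* p) refl (reachProb τ) (∑[ N ] returnProb τ) x))
      (≤-trans (*-monoˡ-≤ (reachProb≥0 τ)
        (∑-mono N λ k _ → *-monoˡ-≤ (Lottery.prob≥0 lottery k)
          (ret (directions (current τ) (Lottery.outcome lottery k)) (return-to-start Γ s τ len k))))
        (bound N))

  ⊩-return : ∀ {τ x} → length τ ≡ steps → 0ℝ ≤ x →
             (∀ ds → walkEnd (current τ) ds ≡ s → x ≤ explorationCost τ + walkLength (current τ) ds) → τ ⊩ x
  ⊩-return {τ} {x} len 0≤x ret zero    _  = leaf τ x len 0≤x ret
  ⊩-return {τ}     len _   _   (suc m) eq = contradiction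
    (ℕₚ.<-≤-trans (ℕₚ.n<1+n _)
      (ℕₚ.≤-trans (ℕ.s≤s (ℕₚ.m≤n+m (length τ) m)) (ℕₚ.≤-reflexive (trans eq (sym len))))) (ℕₚ.n≮n (length τ))

  -- Later steps and the return walk have non-negative cost.
  ⊩-spent : ∀ {τ x} → x ≤ explorationCost τ → τ ⊩ x
  ⊩-spent {τ} x≤ = ⊩-weaken {τ} x≤ (λ m → spent m τ)
    where
    spent : ∀ m τ → m ℕ.+ length τ ≡ steps → reachProb τ * explorationCost τ ≲ extensionCost m τ
    spent zero    τ eq = leaf τ _ eq (explorationCost≥0 τ) λ ds _ → x≤x+y (walkLength≥0 (current τ) ds)
    spent (suc m) τ eq z bound = subst (λ x → reachProb τ * x ≤ z) (average τ _)
      (branch m (later cw) (later ccw) z bound)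
      where
      later : ∀ d → reachProb (d ∷ τ) * explorationCost τ ≲ extensionCost m (d ∷ τ)
      later d z bound = ≤-trans (*-monoˡ-≤ (reachProb≥0 (d ∷ τ)) (x≤x+y (stepCost≥0 τ d)))
        (spent m (d ∷ τ) (trans (ℕₚ.+-suc m (length τ)) eq) z bound)

  -- For the case that either next step is expensive enough, so that the probabilities of the two do
  -- not matter.
  ⊩-step : ∀ {τ x} → length τ ℕ.< steps → (∀ d → x ≤ explorationCost (d ∷ τ)) → τ ⊩ x
  ⊩-step {τ} {x} τ<steps x≤ = subst (τ ⊩_) (average τ x) (⊩-branch τ<steps (⊩-spent (x≤ cw)) (⊩-spent (x≤ ccw)))

  ⊩-decide : ∀ {e τ x y} → length (e ∷ τ) ℕ.< steps → e ∷ e ∷ τ ⊩ x → flip e ∷ e ∷ τ ⊩ y →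
             e ∷ τ ⊩ direct (history (e ∷ τ)) * x + (1ℝ - direct (history (e ∷ τ))) * y
  ⊩-decide {cw}      lt fwd back = ⊩-branch lt fwd back
  ⊩-decide {ccw} {τ} lt fwd back = subst (ccw ∷ τ ⊩_) (+-comm _ _) (⊩-branch lt back fwd)

  ⊩-forced : ∀ {e τ x} → ForwardGreedyAt e τ → length (e ∷ τ) ℕ.< steps → directCost e (e ∷ τ) ≤ backtrackCost e
    (e ∷ τ) →
             e ∷ e ∷ τ ⊩ x → e ∷ τ ⊩ x
  ⊩-forced {e} {τ} {x} greedy lt cheap fwd with reachProb (e ∷ τ) ≤? 0ℝ
  -- Histories of probability zero are exempt from the greedy rule, but for them the claim only says
  -- that costs are non-negative.
  ... | yes r≤0 = ⊩-unreachable (≤-antisym r≤0 (reachProb≥0 (e ∷ τ)))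
  -- Backtracking has probability zero here, so the trivial bound 0 suffices for it.
  ... | no 0<r  = subst (e ∷ τ ⊩_) value (⊩-decide lt fwd (⊩-spent (explorationCost≥0 (flip e ∷ e ∷ τ))))
    where
    value : direct (history (e ∷ τ)) * x + (1ℝ - direct (history (e ∷ τ))) * 0ℝ ≡ x
    value = trans (cong₂ _+_ (trans (cong (_* x) (greedy lt 0<r cheap)) (*-identityˡ x)) (zeroʳ _))
      (+-identityʳ x)

  ⊩⇒≤ : ∀ {x c} → [] ⊩ x → ExpectedCost≤ c → x ≤ c
  ⊩⇒≤ {x} {c} []⊩x cost≤ = subst (_≤ c) (*-identityˡ x)
    ([]⊩x steps (ℕₚ.+-identityʳ steps) c λ N → subst (_≤ c) (truncatedCost≡extensionCost N) (cost≤ N))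

-- The short cycle and the views that it shares with the long cycles.

module Views (ℛ : RealNumbers) where
  open RealNumbers ℛ
  open Exploration ℛ

  -- This view and `detourView` occur on all three cycles, so the agent has to use the same
  -- probabilities there on each of them.
  startView : View
  startView = view 3 (2 , 1ℝ) (4 , 1ℝ)

  detourView : ℝ → View
  detourView δ = view 2 (1 , δ) (3 , 1ℝ)

module ShortCycle (ℛ : RealNumbers) {δ : RealNumbers.ℝ ℛ} (0≤δ : RealNumbers._≤_ ℛ (RealNumbers.0ℝ ℛ) δ) where
  open RealNumbers ℛ
  open OrderedField ℛ
  open Exploration ℛ
  open Views ℛ

  shortWeight : Fin 4 → ℝ
  shortWeight zero                   = 1ℝ
  shortWeight (suc zero)             = 1ℝ
  shortWeight (suc (suc zero))       = 0ℝ
  shortWeight (suc (suc (suc zero))) = δ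

  shortWeight≥0 : ∀ i → 0ℝ ≤ shortWeight i
  shortWeight≥0 zero                   = 0≤1
  shortWeight≥0 (suc zero)             = 0≤1
  shortWeight≥0 (suc (suc zero))       = ≤-refl
  shortWeight≥0 (suc (suc (suc zero))) = 0≤δ

  -- The vertices around the start carry the same identifiers as on the long
  -- cycle.
  shortName : Fin 4 → ℕ
  shortName zero                   = 2
  shortName (suc zero)             = 3
  shortName (suc (suc zero))       = 4
  shortName (suc (suc (suc zero))) = 1

  shortName-injective : ∀ {i j} → shortName i ≡ shortName j → i ≡ j
  shortName-injective {i} {j} eq = trans (sym (inverse i)) (trans (cong named eq) (inverse j))
    where
    named : ℕ → Fin 4
    named 2 = zero
    named 3 = suc zero
    named 4 = suc (suc zero)
    named _ = suc (suc (suc zero))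
    inverse : ∀ i → named (shortName i) ≡ i
    inverse zero                   = refl
    inverse (suc zero)             = refl
    inverse (suc (suc zero))       = refl
    inverse (suc (suc (suc zero))) = refl

  shortCycle : Cycle
  shortCycle = record
    { size           = 4
    ; 3≤size         = s≤s (s≤s (s≤s z≤n))
    ; name           = shortName
    ; name-injective = shortName-injective
    ; weight         = shortWeight
    ; weight≥0       = shortWeight≥0
    }

  module _ (A : Algorithm) where
    open Algorithm A
    open Guarantees ℛ A shortCycle (suc zero)

    -- Only the crossing of `δ` is charged. The optimum is 4 for `2 ≤ δ`, so `ρ`-competitiveness
    -- yields `p q δ ≤ 4 ρ`.
    shortCycle-guarantee :
      let p = first startView ; q = direct (arrive (start startView) 3 (detourView δ)) in
      [] ⊩ (1ℝ - p) * 0ℝ + p * (q * δ + (1ℝ - q) * 0ℝ)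
    shortCycle-guarantee = ⊩-branch (s≤s z≤n) (⊩-spent (explorationCost≥0 (cw ∷ [])))
      (⊩-decide (s≤s (s≤s z≤n)) (⊩-spent (x≤y+x (explorationCost≥0 (ccw ∷ []))))
        (⊩-spent (explorationCost≥0 (cw ∷ ccw ∷ []))))

-- The long cycles, up to the decision at the far end of the path.

module LongCycle (ℛ : RealNumbers) (m : ℕ) {δ H : RealNumbers.ℝ ℛ}
                 (0≤δ : RealNumbers._≤_ ℛ (RealNumbers.0ℝ ℛ) δ)
                   (0≤H : RealNumbers._≤_ ℛ (RealNumbers.0ℝ ℛ) H) where
  open RealNumbers ℛ
  open OrderedField ℛ
  open Exploration ℛ
  open Views ℛ

  -- Position 0 is X, the start is at position 3, and the path, which leads
  -- clockwise from the start, ends at position 4 + m.  Only the weight β of the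
  -- edge between positions 0 and 1 varies.
  innerWeight : ℕ → ℝ
  innerWeight 0 = δ
  innerWeight 1 = 1ℝ
  innerWeight 2 = 1ℝ
  innerWeight (suc (suc (suc k))) = if does (k ℕₚ.<? m) then pow2 k else H

  cycleWeight : ℝ → ℕ → ℝ
  cycleWeight β zero    = β
  cycleWeight β (suc i) = innerWeight i

  cycleWeight≥0 : ∀ {β} → 0ℝ ≤ β → ∀ i → 0ℝ ≤ cycleWeight β i
  cycleWeight≥0 0≤β 0 = 0≤β
  cycleWeight≥0 0≤β 1 = 0≤δ
  cycleWeight≥0 0≤β 2 = 0≤1
  cycleWeight≥0 0≤β 3 = 0≤1
  cycleWeight≥0 0≤β (suc (suc (suc (suc k)))) with does (k ℕₚ.<? m)
  ... | true  = 0≤pow2 k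
  ... | false = 0≤H

  longCycle : ∀ {β} → 0ℝ ≤ β → Cycle
  longCycle {β} 0≤β = record
    { size           = 5 ℕ.+ m
    ; 3≤size         = s≤s (s≤s (s≤s z≤n))
    ; name           = toℕ
    ; name-injective = toℕ-injective
    ; weight         = λ v → cycleWeight β (toℕ v)
    ; weight≥0       = λ v → cycleWeight≥0 0≤β (toℕ v)
    }

  M : ℝ
  M = pow2 m

  doubling-weight : ∀ {k} → k ℕ.< m → innerWeight (3 ℕ.+ k) ≡ pow2 k
  doubling-weight {k} k<m rewrite dec-true (k ℕₚ.<? m) k<m = refl

  heavy-weight : ∀ {k} → ¬ k ℕ.< m → innerWeight (3 ℕ.+ k) ≡ H
  heavy-weight {k} k≮m rewrite dec-false (k ℕₚ.<? m) k≮m = refl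

  last-weight : innerWeight (3 ℕ.+ m) ≡ H
  last-weight = heavy-weight (ℕₚ.n≮n m)

  climb : Dir → ℕ → List Dir → List Dir
  climb d zero    τ = τ
  climb d (suc k) τ = d ∷ climb d k τ

  -- Leads to position `4 + m`: the path has one edge of weight 1 followed by the `m` edges `pow2 0`
  -- to `pow2 (m - 1)`.
  top : List Dir → List Dir
  top b = climb cw (suc m) b

  -- The agent starts clockwise, either at once or after one step to the other side.
  data Prelude : List Dir → Set where
    none   : Prelude []
    detour : Prelude (ccw ∷ [])

  module Exploring (A : Algorithm) (greedy : ForwardGreedy A) {β : ℝ} (0≤β : 0ℝ ≤ β) where
    Γ : Cycle
    Γ = longCycle 0≤β
    open Algorithm A
    open Cycle Γ
    open Tours ℛ Γ public

    s : Vertex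
    s = pos 3
    open Guarantees ℛ A Γ s public

    w≡ : ∀ {i} → i ℕ.< size → w i ≡ cycleWeight β i
    w≡ i<n = cong (cycleWeight β) (toℕ-pos i<n)

    at-cw : ∀ k → k ℕ.≤ 2 ℕ.+ m → at cw k ≡ pos (3 ℕ.+ k)
    at-cw zero    _   = refl
    at-cw (suc k) k<n = trans (cong (move cw) (at-cw k (ℕₚ.<⇒≤ k<n))) (move-cw-pos (s≤s (s≤s (s≤s k<n))))

    at-ccw : ∀ k i → i ℕ.+ k ≡ 3 → at ccw k ≡ pos i
    at-ccw zero    i eq = cong pos (trans (sym eq) (ℕₚ.+-identityʳ i))
    at-ccw (suc k) i eq = trans (cong (move ccw) (at-ccw k (suc i) eq′))
      (move-ccw-pos (ℕₚ.≤-trans (ℕₚ.m≤m+n (suc i) k) (ℕₚ.≤-trans (ℕₚ.≤-reflexive eq′) (s≤s (s≤s (s≤s z≤n))))))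
      where eq′ = trans (sym (ℕₚ.+-suc i k)) eq

    edge-cw : ∀ {k} → k ℕ.≤ 1 ℕ.+ m → edge cw (at cw k) ≡ innerWeight (2 ℕ.+ k)
    edge-cw {k} k≤ = trans (cong weight (at-cw k (ℕₚ.m≤n⇒m≤1+n k≤))) (w≡ (s≤s (s≤s (s≤s (s≤s k≤)))))

    edge-ccw : ∀ k i → suc i ℕ.+ k ≡ 3 → edge ccw (at ccw k) ≡ cycleWeight β i
    edge-ccw k i eq = trans (cong weight (at-ccw (suc k) i (trans (ℕₚ.+-suc i k) eq)))
      (w≡ (ℕₚ.≤-trans (ℕₚ.m≤m+n (suc i) k) (ℕₚ.≤-trans (ℕₚ.≤-reflexive eq) (s≤s (s≤s (s≤s z≤n))))))

    arm-cw : ∀ k → k ℕ.≤ m → arm cw (suc k) ≡ pow2 k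
    arm-cw zero    _   = +-identityˡ 1ℝ
    arm-cw (suc k) k<m = cong₂ _+_ (arm-cw k (ℕₚ.<⇒≤ k<m))
      (trans (edge-cw (ℕₚ.m≤n⇒m≤1+n k<m)) (doubling-weight k<m))

    arm-cw-last : arm cw (2 ℕ.+ m) ≡ M + H
    arm-cw-last = cong₂ _+_ (arm-cw m ℕₚ.≤-refl) (trans (edge-cw ℕₚ.≤-refl) last-weight)

    ∑w : ∀ k → k ℕ.≤ m → ∑[ 4 ℕ.+ k ] w ≡ β + δ + 1ℝ + pow2 k
    ∑w zero    _   = cong (λ x → x + δ + 1ℝ + 1ℝ) (+-identityˡ β)
    ∑w (suc k) k<m = trans (cong₂ _+_ (∑w k (ℕₚ.<⇒≤ k<m))
      (trans (w≡ (s≤s (s≤s (s≤s (s≤s (ℕₚ.m<n⇒m<1+n k<m)))))) (doubling-weight k<m)))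
      (+-assoc _ (pow2 k) (pow2 k))

    pathWeight≡ : pathWeight ≡ β + δ + 1ℝ + M
    pathWeight≡ = ∑w m ℕₚ.≤-refl

    lastWeight≡ : w (4 ℕ.+ m) ≡ H
    lastWeight≡ = trans (w≡ ℕₚ.≤-refl) last-weight

    totalWeight≡ : totalWeight ≡ β + δ + 1ℝ + M + H
    totalWeight≡ = cong₂ _+_ pathWeight≡ lastWeight≡

    explored-cw : ∀ k b → explored cw (climb cw k b) ≡ k ℕ.+ explored cw b
    explored-cw zero    b = refl
    explored-cw (suc k) b = cong suc (explored-cw k b)

    explored-ccw : ∀ k b → explored ccw (climb cw k b) ≡ explored ccw b
    explored-ccw zero    b = refl
    explored-ccw (suc k) b = explored-ccw k b

    length-climb : ∀ k b → length (climb cw k b) ≡ k ℕ.+ length b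
    length-climb zero    b = refl
    length-climb (suc k) b = cong suc (length-climb k b)

    explored-cw₀ : ∀ {b} → Prelude b → ∀ k → explored cw (climb cw k b) ≡ k
    explored-cw₀ none   k = trans (explored-cw k []) (ℕₚ.+-identityʳ k)
    explored-cw₀ detour k = trans (explored-cw k _) (ℕₚ.+-identityʳ k)

    length≤1 : ∀ {b} → Prelude b → length b ℕ.≤ 1
    length≤1 none   = z≤n
    length≤1 detour = s≤s z≤n

    length-climb≤ : ∀ {b} → Prelude b → ∀ k → length (climb cw k b) ℕ.≤ suc k
    length-climb≤ {b} pre k = ℕₚ.≤-trans (ℕₚ.≤-reflexive (length-climb k b))
      (ℕₚ.≤-trans (ℕₚ.+-monoʳ-≤ k (length≤1 pre)) (ℕₚ.≤-reflexive (ℕₚ.+-comm k 1)))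

    explorationCost-climb : ∀ {b} → Prelude b → ∀ k → k ℕ.≤ m → pow2 k ≤ explorationCost (climb cw (suc k) b)
    explorationCost-climb none   zero _ = x≤y+x ≤-refl
    -- This clockwise step is a backtracking move, whose cost contains the first edge of the path.
    explorationCost-climb detour zero _ =
      ≤-trans (≤-reflexive (sym (arm-cw 0 z≤n)))
        (≤-trans (x≤y+x (arm≥0 ccw 1)) (x≤y+x (explorationCost≥0 (ccw ∷ []))))
    explorationCost-climb {b} pre (suc k) k<m = +-mono-≤ (explorationCost-climb pre k (ℕₚ.<⇒≤ k<m))
      (≤-reflexive (sym (trans (cong (λ i → edge cw (at cw i)) (explored-cw₀ pre (suc k)))
        (trans (edge-cw (ℕₚ.m≤n⇒m≤1+n k<m)) (doubling-weight k<m)))))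

    -- The next edge weighs `pow2 k`, exactly the distance back to the start, so a direct move never
    -- costs more than backtracking and is forced up to the far end.
    ⊩-climb : ∀ {b x} → Prelude b → ∀ j k → j ℕ.+ k ≡ m → climb cw (suc m) b ⊩ x → climb cw (suc k) b ⊩ x
    ⊩-climb pre zero    k refl top = top
    ⊩-climb {b} pre (suc j) k eq top = ⊩-forced (greedy Γ s cw (climb cw k b))
      (ℕₚ.≤-trans (s≤s (length-climb≤ pre (suc k))) (s≤s (s≤s (ℕₚ.≤-trans k<m (ℕₚ.m≤n+m m 2)))))
      cheap (⊩-climb pre j (suc k) (trans (ℕₚ.+-suc j k) eq) top)
      where
      k<m : k ℕ.< m
      k<m = ℕₚ.≤-trans (ℕₚ.m≤n+m (suc k) j) (ℕₚ.≤-reflexive (trans (ℕₚ.+-suc j k) eq))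
      cheap : directCost cw (climb cw (suc k) b) ≤ backtrackCost cw (climb cw (suc k) b)
      cheap = subst (λ i → edge cw (at cw i) ≤ arm cw i + arm ccw (suc (explored ccw (climb cw (suc k) b))))
        (sym (explored-cw₀ pre (suc k))) (≤-trans
          (≤-reflexive (trans (edge-cw (ℕₚ.m≤n⇒m≤1+n k<m))
            (trans (doubling-weight k<m) (sym (arm-cw k (ℕₚ.<⇒≤ k<m))))))
          (x≤x+y (arm≥0 ccw (suc (explored ccw (climb cw k b))))))

    directProb : Trajectory → ℝ
    directProb b = direct (history (top b))

    top<steps : ∀ {b} → Prelude b → length (top b) ℕ.< steps
    top<steps pre = s≤s (ℕₚ.≤-trans (length-climb≤ pre (suc m)) (ℕₚ.n≤1+n _))

    crossing-cost : ∀ {b} → Prelude b → M + H ≤ explorationCost (cw ∷ top b)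
    crossing-cost pre = +-mono-≤ (explorationCost-climb pre m ℕₚ.≤-refl) (≤-reflexive (sym
      (trans (cong (λ i → edge cw (at cw i)) (explored-cw₀ pre (suc m)))
        (trans (edge-cw ℕₚ.≤-refl) last-weight))))

    backtracking-cost : ∀ {b} → Prelude b → M + M ≤ explorationCost (ccw ∷ top b)
    backtracking-cost {b} pre = +-mono-≤ (explorationCost-climb pre m ℕₚ.≤-refl) (≤-trans
      (≤-reflexive (sym (trans (cong (arm cw) (explored-cw₀ pre (suc m))) (arm-cw m ℕₚ.≤-refl))))
        (x≤x+y (arm≥0 ccw (suc (explored ccw (climb cw m b))))))

    -- Nothing is charged beyond the next step. This suffices for `β = 0`, where the rest of the
    -- tour can be done at a cost of order `δ`.
    top-guarantee : ∀ {b} → Prelude b → top b ⊩ directProb b * (M + H) + (1ℝ - directProb b) * (M + M)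
    top-guarantee pre = ⊩-decide (top<steps pre) (⊩-spent (crossing-cost pre)) (⊩-spent (backtracking-cost pre))

    -- The first decisions of the agent.

    viewAt-lo≡ccw : ∀ v → toward v lo ≡ ccw → viewAt v ≡ view (toℕ v) (toℕ (move ccw v) , edge ccw v)
      (toℕ (move cw v) , edge cw v)
    viewAt-lo≡ccw v = cong λ d → view (toℕ v) (toℕ (move d v) , edge d v)
      (toℕ (move (flip d) v) , edge (flip d) v)

    pos2≡ : move ccw s ≡ pos 2
    pos2≡ = at-ccw 1 2 refl

    pos1≡ : move ccw (pos 2) ≡ pos 1
    pos1≡ = move-ccw-pos (s≤s (s≤s z≤n))

    toward-s : toward s lo ≡ ccw
    toward-s = cong (λ u → if 4 <ᵇ toℕ u then cw else ccw) pos2≡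

    viewAt-s : viewAt s ≡ startView
    viewAt-s = trans (viewAt-lo≡ccw s toward-s) (cong (λ u → view 3 (toℕ u , weight u) (4 , 1ℝ)) pos2≡)

    viewAt-2 : viewAt (pos 2) ≡ detourView δ
    viewAt-2 = trans (viewAt-lo≡ccw (pos 2) (cong (λ u → if 3 <ᵇ toℕ u then cw else ccw) pos1≡))
      (cong (λ u → view 2 (toℕ u , weight u) (3 , 1ℝ)) pos1≡)

    history-detour : history (ccw ∷ []) ≡ arrive (start startView) 3 (detourView δ)
    history-detour = cong₂ (λ x y → arrive (start x) 3 y) viewAt-s (trans (cong viewAt pos2≡) viewAt-2)

    -- The edge listed first at the start leads counterclockwise, so `p` is the probability of the
    -- detour and `q` that of then crossing `δ`.
    ⊩-start : ∀ {x y x′} → (cw ∷ []) ⊩ x → (ccw ∷ ccw ∷ []) ⊩ y → (cw ∷ ccw ∷ []) ⊩ x′ →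
              let p = first startView ; q = direct (arrive (start startView) 3 (detourView δ)) in
              [] ⊩ (1ℝ - p) * x + p * (q * y + (1ℝ - q) * x′)
    ⊩-start {x} {y} {x′} ⊩x ⊩y ⊩x′ =
      subst₂ (λ v h → [] ⊩ (1ℝ - first v) * x + first v * (direct h * y + (1ℝ - direct h) * x′)) viewAt-s history-detour
        (subst₂ (λ a b → [] ⊩ a * x + b * (direct
          (history (ccw ∷ [])) * y + (1ℝ - direct (history (ccw ∷ []))) * x′))
          (first-step cw) (first-step ccw)
          (⊩-branch (s≤s z≤n) ⊩x (⊩-decide (s≤s (s≤s z≤n)) ⊩y ⊩x′)))
      where
      first-step : ∀ d → stepProb [] d ≡ portProb (portToward ccw d)
      first-step d = trans (stepProb-first d) (cong (λ e → portProb (portToward e d)) toward-s)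

    -- Trajectories that cross `δ` right after the detour are charged 0 here; the short cycle
    -- accounts for them.
    ⊩-whole : ∀ {x x′} → top [] ⊩ x → top (ccw ∷ []) ⊩ x′ →
              let p = first startView ; q = direct (arrive (start startView) 3 (detourView δ)) in
              [] ⊩ (1ℝ - p) * x + p * (q * 0ℝ + (1ℝ - q) * x′)
    ⊩-whole ⊩x ⊩x′ = ⊩-start (⊩-climb none m 0 (ℕₚ.+-identityʳ m) ⊩x)
      (⊩-spent (explorationCost≥0 (ccw ∷ ccw ∷ []))) (⊩-climb detour m 0 (ℕₚ.+-identityʳ m) ⊩x′)

    -- A lower bound for the distance to the start if β = M + H.
    potential : ℕ → ℝ
    potential 0 = M + H
    potential 1 = 0ℝ
    potential 2 = 0ℝ
    potential 3 = 0ℝ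
    potential (suc (suc (suc (suc k)))) = pow2 k

    -- The long cycle with `β = M + H`.

    module HeavyClosing (β≡ : β ≡ M + H) (δ≤M : δ ≤ M) where

      M≥0 : 0ℝ ≤ M
      M≥0 = 0≤pow2 m

      M+H≥0 : 0ℝ ≤ M + H
      M+H≥0 = +-nonNegative M≥0 0≤H

      -- A function that changes along each edge by at most its weight and vanishes at the start
      -- bounds the distance to the start from below.
      Lipschitz : ℕ → ℕ → Set
      Lipschitz i j = potential i ≤ w i + potential j × potential j ≤ w i + potential i

      lipschitz-of : ∀ i j {x} → i ℕ.< size → cycleWeight β i ≡ x → potential i ≤ x + potential j →
        potential j ≤ x + potential i → Lipschitz i j
      lipschitz-of i j i<n refl le ge rewrite w≡ i<n = le , ge

      lipschitz : ∀ i → i ℕ.< size → Lipschitz i (toℕ (pos (suc i)))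
      lipschitz 0 i<n = lipschitz-of 0 1 i<n β≡ (x≤x+y ≤-refl) (+-nonNegative M+H≥0 M+H≥0)
      lipschitz 1 i<n = lipschitz-of 1 2 i<n refl (+-nonNegative 0≤δ ≤-refl) (+-nonNegative 0≤δ ≤-refl)
      lipschitz 2 i<n = lipschitz-of 2 3 i<n refl (+-nonNegative 0≤1 ≤-refl) (+-nonNegative 0≤1 ≤-refl)
      lipschitz 3 i<n = lipschitz-of 3 4 i<n refl (+-nonNegative 0≤1 0≤1) (x≤x+y ≤-refl)
      lipschitz (suc (suc (suc (suc k)))) i<n with ℕₚ.m≤n⇒m<n∨m≡n i<n
      ... | inj₁ 5+k<5+m = subst (Lipschitz (4 ℕ.+ k)) (sym (toℕ-pos 5+k<5+m))
        (lipschitz-of (4 ℕ.+ k) (5 ℕ.+ k) i<n (doubling-weight k<m)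
          (x≤x+y (+-nonNegative (0≤pow2 k) (0≤pow2 k))) ≤-refl)
        where
        k<m : k ℕ.< m
        k<m = ℕₚ.+-cancelˡ-< 5 k m 5+k<5+m
      -- The edge of weight `H` wraps around to position 0, where the potential exceeds that of the
      -- far end by exactly `H`.
      ... | inj₂ refl = subst (Lipschitz (4 ℕ.+ m)) (sym (cong toℕ pos-size))
        (lipschitz-of (4 ℕ.+ m) 0 i<n last-weight
          (≤-trans (x≤x+y {M} 0≤H) (x≤y+x 0≤H)) (≤-reflexive (+-comm M H)))

      potential-edge : ∀ d v → potential (toℕ v) ≤ edge d v + potential (toℕ (move d v))
      potential-edge d v with edgeEnds d v | lipschitz (edgeIndex d v) (edgeIndex<size d v)
      ... | inj₁ (v≡ , m≡) | le , _ rewrite edge≡w d v | m≡ =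
        subst (λ i → potential i ≤ w (edgeIndex d v) + potential (toℕ (pos (suc (edgeIndex d v)))))
          (sym (trans (cong toℕ v≡) (toℕ-pos (edgeIndex<size d v)))) le
      ... | inj₂ (v≡ , m≡) | _ , ge rewrite edge≡w d v =
        subst₂ (λ i j → potential i ≤ w (edgeIndex d v) + potential j) (sym (cong toℕ v≡))
          (sym (trans (cong toℕ m≡) (toℕ-pos (edgeIndex<size d v)))) ge

      potential-walk : ∀ v ds → potential (toℕ v) ≤ walkLength v ds + potential (toℕ (walkEnd v ds))
      potential-walk v []       = ≤-reflexive (sym (+-identityˡ _))
      potential-walk v (d ∷ ds) = ≤-trans (potential-edge d v) (≤-trans
        (+-mono-≤ ≤-refl (potential-walk (move d v) ds)) (≤-reflexive (sym (+-assoc (edge d v) _ _))))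

      return-length : ∀ {v} ds → v ≡ pos 0 → walkEnd v ds ≡ s → M + H ≤ walkLength v ds
      return-length {v} ds refl end = subst (M + H ≤_)
        (trans (cong (λ u → walkLength v ds + potential (toℕ u)) end) (+-identityʳ _)) (potential-walk v ds)

      edge-cw-last : edge cw (at cw (2 ℕ.+ m)) ≡ M + H
      edge-cw-last = trans (cong weight (trans (at-cw (2 ℕ.+ m) ℕₚ.≤-refl) pos-size)) β≡

      -- At X the next edge weighs `β = M + H`, and backtracking first returns to the start over `H`
      -- and the path, which costs as much.
      ⊩-crossed : ∀ {b} → Prelude b → cw ∷ top b ⊩ M + H + (M + H)
      ⊩-crossed {b} pre = ⊩-step (s≤s (s≤s (length-climb≤ pre (suc m)))) λ where
        cw → +-mono-≤ (crossing-cost pre) (≤-reflexive (sym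
          (trans (cong (λ i → edge cw (at cw i)) (explored-cw₀ pre (2 ℕ.+ m))) edge-cw-last)))
        ccw → +-mono-≤ (crossing-cost pre) (≤-trans (≤-reflexive (sym
          (trans (cong (arm cw) (explored-cw₀ pre (2 ℕ.+ m))) arm-cw-last)))
            (x≤x+y (arm≥0 ccw (suc (explored ccw (climb cw m b))))))

      -- The agent is at position 1 and only X is unvisited. The way around through the start costs
      -- at least `M + H = β`, so crossing `β` is forced, and any way back from X costs at least
      -- `M + H` again.
      ⊩-far-side : ∀ {τ} → explored ccw τ ≡ 1 → explored cw τ ≡ suc m → length τ ≡ 2 ℕ.+ m → M + M ≤
        explorationCost (ccw ∷ τ) →
                   ccw ∷ τ ⊩ M + M + (M + H) + (M + H)
      ⊩-far-side {τ} eccw ecw len cost = ⊩-forced (greedy Γ s ccw τ)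
        (ℕₚ.≤-reflexive (cong (λ l → suc (suc l)) len))
        (subst₂ _≤_ (sym cost≡) (cong (λ i → distanceToStart ccw (ccw ∷ τ) + arm cw (suc i)) (sym ecw))
          (≤-trans (≤-reflexive (sym arm-cw-last)) (x≤y+x (arm≥0 ccw (suc (explored ccw τ))))))
        (⊩-return (cong (λ l → suc (suc l)) len)
          (+-nonNegative (+-nonNegative (+-nonNegative M≥0 M≥0) M+H≥0) M+H≥0) λ ds end →
          +-mono-≤ (+-mono-≤ cost (≤-reflexive (sym cost≡)))
            (return-length ds (trans (cong (λ i → at ccw (suc (suc i))) eccw) (at-ccw 3 0 refl)) end))
        where
        cost≡ : directCost ccw (ccw ∷ τ) ≡ M + H
        cost≡ = trans (cong (λ i → edge ccw (at ccw (suc i))) eccw) (trans (edge-ccw 2 0 refl) β≡)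

      ⊩-backtracked : ∀ {b} → Prelude b → ccw ∷ top b ⊩ M + M + (M + H) + (M + H)
      -- The detour has explored position 2, so backtracking ends at position 1.
      ⊩-backtracked detour = ⊩-far-side (explored-ccw (suc m) (ccw ∷ [])) (explored-cw₀ detour (suc m))
        (trans (length-climb (suc m) (ccw ∷ [])) (ℕₚ.+-comm (suc m) 1)) (backtracking-cost detour)
      -- Backtracking ends at position 2, where `δ ≤ M` forces a further direct step to position 1.
      ⊩-backtracked none = ⊩-forced (greedy Γ s ccw (top [])) (s≤s (s≤s (s≤s (length-climb≤ none m))))
        (subst₂ _≤_ (sym (trans (cong (λ i → edge ccw (at ccw (suc i))) (explored-ccw (suc m) []))
          (edge-ccw 1 1 refl)))
          (cong (λ i → distanceToStart ccw (ccw ∷ top []) + arm cw (suc i)) (sym (explored-cw₀ none (suc m))))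
          (≤-trans (≤-trans δ≤M (≤-trans (x≤x+y 0≤H) (≤-reflexive (sym arm-cw-last))))
            (x≤y+x (arm≥0 ccw (suc (explored ccw (climb cw m [])))))))
        (⊩-far-side (cong suc (explored-ccw (suc m) [])) (explored-cw₀ none (suc m))
          (cong suc (trans (length-climb (suc m) []) (ℕₚ.+-identityʳ (suc m))))
          (≤-trans (backtracking-cost none) (x≤x+y (stepCost≥0 (ccw ∷ top []) ccw))))

      heavy-top-guarantee : ∀ {b} → Prelude b →
        top b ⊩ directProb b * (M + H + (M + H)) + (1ℝ - directProb b) * (M + M + (M + H) + (M + H))
      heavy-top-guarantee pre = ⊩-decide (top<steps pre) (⊩-crossed pre) (⊩-backtracked pre)

  -- Indistinguishability of the long cycles before the decision.

  module Indistinguishable (A : Algorithm) (greedy : ForwardGreedy A) {β β′ : ℝ} (0≤β : 0ℝ ≤ β)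
    (0≤β′ : 0ℝ ≤ β′) where
    open Exploring A greedy 0≤β
    module ′ = Exploring A greedy 0≤β′

    viewAt-cong : ∀ v → (∀ d → Cycle.edge Γ d v ≡ Cycle.edge ′.Γ d v) → viewAt v ≡ ′.viewAt v
    viewAt-cong v eq = cong₂ (view (toℕ v)) (neighbour (toward v lo)) (neighbour (toward v hi))
      where
      neighbour : ∀ d → (toℕ (Cycle.move Γ d v) , Cycle.edge Γ d v) ≡
        (toℕ (Cycle.move ′.Γ d v) , Cycle.edge ′.Γ d v)
      neighbour cw  = cong (toℕ (Cycle.move Γ cw v) ,_) (eq cw)
      neighbour ccw = cong (toℕ (Cycle.move Γ ccw v) ,_) (eq ccw)

    -- The edge of weight `β` joins positions 0 and 1; positions 3 to `4 + m` are not incident to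
    -- it.
    viewAt-climb : ∀ k → k ℕ.≤ 1 ℕ.+ m → viewAt (at cw k) ≡ ′.viewAt (′.at cw k)
    viewAt-climb k k≤ = trans (cong viewAt (at-cw k k≤′))
      (trans (viewAt-cong (pos (3 ℕ.+ k)) same) (cong ′.viewAt (sym (′.at-cw k k≤′))))
      where
      k≤′ = ℕₚ.m≤n⇒m≤1+n k≤
      same : ∀ d → Cycle.edge Γ d (pos (3 ℕ.+ k)) ≡ Cycle.edge ′.Γ d (pos (3 ℕ.+ k))
      same cw  = trans (w≡ (s≤s (s≤s (s≤s (s≤s k≤))))) (sym (′.w≡ (s≤s (s≤s (s≤s (s≤s k≤))))))
      same ccw = trans (cong (Cycle.weight Γ) (move-ccw-pos (s≤s (s≤s (s≤s k≤′)))))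
        (trans (trans (w≡ (s≤s (s≤s (s≤s k≤′)))) (sym (′.w≡ (s≤s (s≤s (s≤s k≤′))))))
          (cong (Cycle.weight ′.Γ) (sym (′.move-ccw-pos (s≤s (s≤s (s≤s k≤′)))))))

    history-climb : ∀ {b} → Prelude b → ∀ k → k ℕ.≤ 1 ℕ.+ m → history (climb cw k b) ≡ ′.history (climb cw k b)
    history-climb none   zero _ = cong start (trans viewAt-s (sym ′.viewAt-s))
    history-climb detour zero _ = trans history-detour (sym ′.history-detour)
    history-climb {b} pre (suc k) k< = cong₂ (λ h (n , v) → arrive h n v) (history-climb pre k (ℕₚ.<⇒≤ k<))
      (trans (cong (λ i → toℕ (at cw i) , viewAt (at cw (suc i))) (explored-cw₀ pre k))
        (trans (cong₂ _,_ (cong toℕ (trans (at-cw k k≤) (sym (′.at-cw k k≤)))) (viewAt-climb (suc k) k<))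
          (cong (λ i → toℕ (′.at cw i) , ′.viewAt (′.at cw (suc i))) (sym (′.explored-cw₀ pre k)))))
      where
      k≤ : k ℕ.≤ 2 ℕ.+ m
      k≤ = ℕₚ.≤-trans (ℕₚ.<⇒≤ k<) (ℕₚ.n≤1+n _)

    directProb-cong : ∀ {b} → Prelude b → directProb b ≡ ′.directProb b
    directProb-cong pre = cong (Algorithm.direct A) (history-climb pre (suc m) ℕₚ.≤-refl)

-- Weighted combination of the competitiveness inequalities.

module Combination (ℛ : RealNumbers) where
  open RealNumbers ℛ
  open OrderedField ℛ
  open Solver using (solve; con; _:+_; _:*_; _:=_)
  open Mult (CommutativeRing.semiring commutativeRing) using () renaming (_×_ to _·_)

  infix 9 #_
  -- The form in which the solver interprets `con n`, so that its identities apply directly; `# 2`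
  -- computes to `2ℝ`.
  #_ : ℕ → ℝ
  # n = n · 1ℝ

  #≥0 : ∀ n → 0ℝ ≤ # n
  #≥0 zero          = ≤-refl
  #≥0 (suc zero)    = 0≤1
  #≥0 (suc (suc n)) = +-nonNegative (#≥0 (suc n)) 0≤1

  module Ratio {t : ℝ} (0≤t : 0ℝ ≤ t) (t²≡2 : t * t ≡ 2ℝ) where

    1≤t : 1ℝ ≤ t
    1≤t with 1ℝ ≤? t
    ... | yes 1≤t = 1≤t
    ... | no t<1  = contradiction
      (+-cancelʳ-≤ 1ℝ (≤-trans (subst (_≤ t) t²≡2 (subst (t * t ≤_) (*-identityʳ t) (*-monoˡ-≤ 0≤t (<⇒≤ t<1))))
        (subst (t ≤_) (sym (+-identityˡ 1ℝ)) (<⇒≤ t<1)))) 0<1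

    -- H is chosen such that `crossing-value` and `backtracking-value` agree.
    scale : ℝ
    scale = # 8 + # 6 * t

    scale≥0 : 0ℝ ≤ scale
    scale≥0 = +-nonNegative (#≥0 8) (*-nonNegative (#≥0 6) 0≤t)

    -- The solver does not know that `t * t ≡ 2ℝ`; identities are brought into this form, where the
    -- square is replaced by hand.
    expand-t² : ∀ a b c M → (a + b * t + c * (t * t)) * M ≡ (a + b * t + c * 2ℝ) * M
    expand-t² a b c M = cong (λ x → (a + b * t + c * x) * M) t²≡2

    module _ (M : ℝ) where
      H : ℝ
      H = M + t * M

      crossing-value : 2ℝ * (M + H) + t * (M + H + (M + H)) ≡ scale * M
      crossing-value = trans
        (solve 2 (λ t M → let H = M :+ t :* M in con 2 :* (M :+ H) :+ t :* (M :+ H :+ (M :+ H)) :=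
          (con 4 :+ con 6 :* t :+ con 2 :* (t :* t)) :* M) refl t M)
        (trans (expand-t² (# 4) (# 6) (# 2) M)
          (solve 2 (λ t M → (con 4 :+ con 6 :* t :+ con 2 :* con 2) :* M := (con 8 :+ con 6 :* t) :* M) refl
            t M))

      backtracking-value : 2ℝ * (M + M) + t * (M + M + (M + H) + (M + H)) ≡ scale * M
      backtracking-value = trans
        (solve 2 (λ t M → let H = M :+ t :* M in con 2 :* (M :+ M) :+ t :* (M :+ M :+ (M :+ H) :+ (M :+ H)) :=
          (con 4 :+ con 6 :* t :+ con 2 :* (t :* t)) :* M) refl t M)
        (trans (expand-t² (# 4) (# 6) (# 2) M)
          (solve 2 (λ t M → (con 4 :+ con 6 :* t :+ con 2 :* con 2) :* M := (con 8 :+ con 6 :* t) :* M) refl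
            t M))

      -- Lower bounds for the expected cost after the decision at the far end of the
      -- path, for β = 0 and β = M + H, if H is crossed with probability f.
      light heavy : ℝ → ℝ
      light f = f * (M + H) + (1ℝ - f) * (M + M)
      heavy f = f * (M + H + (M + H)) + (1ℝ - f) * (M + M + (M + H) + (M + H))

      -- Crossing and backtracking have the same weighted value, hence so has every mixture of them.
      mixed-value : ∀ f → 2ℝ * light f + t * heavy f ≡ scale * M
      mixed-value f = trans
        (solve 7 (λ t f f′ a b c d → con 2 :* (f :* a :+ f′ :* b) :+ t :* (f :* c :+ f′ :* d)
          := f :* (con 2 :* a :+ t :* c) :+ f′ :* (con 2 :* b :+ t :* d))
          refl t f (1ℝ - f) (M + H) (M + M) (M + H + (M + H)) (M + M + (M + H) + (M + H)))
        (trans (cong₂ (λ x y → f * x + (1ℝ - f) * y) crossing-value backtracking-value)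
          (trans (sym (distribʳ (scale * M) f (1ℝ - f)))
            (trans (cong (_* (scale * M)) (p+1-p≡1 f)) (*-identityˡ (scale * M)))))

      -- The optima of the two long cycles, combined with the same weights 2 and t
      -- and without the contributions of the detour.
      optima : ℝ
      optima = # 4 * M + t * (M + H + (M + H))

      half : (1ℝ + t) * 2ℝ ⁻¹ * 2ℝ ≡ 1ℝ + t
      half = trans (*-assoc (1ℝ + t) (2ℝ ⁻¹) 2ℝ)
        (trans (cong ((1ℝ + t) *_) (trans (*-comm (2ℝ ⁻¹) 2ℝ) (⁻¹-inverse 2ℝ 2≢0))) (*-identityʳ (1ℝ + t)))
        where
        2≢0 : 2ℝ ≢ 0ℝ
        2≢0 eq = 0<1 (≤-trans (x≤x+y 0≤1) (≤-reflexive eq))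

      -- The source of the ratio: `optima` is `(8 + 4 t) M`, and `(1 + t) (4 + 2 t) = 8 + 6 t`.
      ratio-optima : (1ℝ + t) * 2ℝ ⁻¹ * optima ≡ scale * M
      ratio-optima = trans
        (solve 3 (λ c t M → let H = M :+ t :* M in c :* (con 4 :* M :+ t :* (M :+ H :+ (M :+ H)))
          := c :* con 2 :* ((con 2 :+ con 2 :* t :+ con 1 :* (t :* t)) :* M)) refl ((1ℝ + t) * 2ℝ ⁻¹) t M)
        (trans (cong₂ _*_ half (expand-t² (# 2) (# 2) (# 1) M))
          (trans (solve 2 (λ t M → (con 1 :+ t) :* ((con 2 :+ con 2 :* t :+ con 1 :* con 2) :* M) :=
            (con 4 :+ con 6 :* t :+ con 2 :* (t :* t)) :* M) refl t M)
            (trans (expand-t² (# 4) (# 6) (# 2) M)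
              (solve 2 (λ t M → (con 4 :+ con 6 :* t :+ con 2 :* con 2) :* M := (con 8 :+ con 6 :* t) :* M) refl
                t M))))

    -- The coefficient of `δ` in the lower-order terms: those of the two long optima, with `δ + 1`
    -- estimated by `2 δ`, and the optimum 4 of the short cycle with weight `scale * δ`.
    errorBound : ℝ → ℝ
    errorBound ρ = ρ * (# 2 * (# 4 + t) + # 4 * scale)

    -- The inequalities of the short, light and heavy cycles are added with weights `scale * δ`, 2
    -- and `t`. The left side becomes `scale * M`, which is `ρ + κ` times `optima`; the right side
    -- is `ρ * optima` up to order `δ`. As `M ≤ optima`, dividing by `δ` leaves a bound for `κ * δ`.
    combine : ∀ {ρ κ δ M p q f g} → M ≡ δ * δ → 1ℝ ≤ δ → 0ℝ ≤ ρ → 0ℝ ≤ κ → (1ℝ + t) * 2ℝ ⁻¹ ≡ ρ + κ →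
      (1ℝ - p) * 0ℝ + p * (q * δ + (1ℝ - q) * 0ℝ) ≤ ρ * # 4 →
      (1ℝ - p) * light M f + p * (q * 0ℝ + (1ℝ - q) * light M g) ≤ ρ * (0ℝ + δ + 1ℝ + M + (0ℝ + δ + 1ℝ + M)) →
      (1ℝ - p) * heavy M f + p * (q * 0ℝ + (1ℝ - q) * heavy M g) ≤ ρ * (M + H M + δ + 1ℝ + M + H M) →
      κ * δ ≤ errorBound ρ
    combine {ρ} {κ} {δ} {M} {p} {q} {f} {g} refl 1≤δ 0≤ρ 0≤κ c≡ short≤ light≤ heavy≤ = *-cancelˡ-≤ {z = δ}
      (λ δ≤0 → 0<1 (≤-trans 1≤δ δ≤0))
      (≤-trans κM≤ (+-cancelʳ-≤ (ρ * optima M) (≤-trans (≤-reflexive lower) (≤-trans total≤ error≤))))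
      where
      0≤δ = ≤-trans 0≤1 1≤δ
      0≤M : 0ℝ ≤ M
      0≤M = *-nonNegative 0≤δ 0≤δ
      E = scale * M
      κM≤ : δ * (κ * δ) ≤ κ * optima M
      κM≤ = ≤-trans (≤-reflexive (solve 2 (λ d k → d :* (k :* d) := k :* (d :* d)) refl δ κ)) (*-monoˡ-≤ 0≤κ
        (≤-slack (+-nonNegative (*-nonNegative (#≥0 3) 0≤M) (*-nonNegative 0≤t (+-nonNegative 0≤M+H 0≤M+H)))
          (solve 3 (λ t M X → M :+ (con 3 :* M :+ t :* X) := con 4 :* M :+ t :* X) refl t M
            (M + H M + (M + H M)))))
        where
        0≤M+H : 0ℝ ≤ M + H M
        0≤M+H = +-nonNegative 0≤M (+-nonNegative 0≤M (*-nonNegative 0≤t 0≤M))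
      lower : κ * optima M + ρ * optima M ≡ E
      lower = trans (trans (+-comm _ _) (sym (distribʳ (optima M) ρ κ)))
        (trans (cong (_* optima M) (sym c≡)) (ratio-optima M))
      upper : ℝ
      upper = 2ℝ * (ρ * (0ℝ + δ + 1ℝ + M + (0ℝ + δ + 1ℝ + M))) + t * (ρ * (M + H M + δ + 1ℝ + M + H M)) + scale * δ * (ρ * # 4)
      -- On the long cycles the branch that crosses `δ` is charged 0. The short cycle charges it
      -- `δ`, and the weight `scale * δ` turns this into `scale * M`, the value of every other
      -- branch.
      split : E ≡ 2ℝ * ((1ℝ - p) * light M f + p * (q * 0ℝ + (1ℝ - q) * light M g)) + t * ((1ℝ - p) * heavy M f + p * (q * 0ℝ + (1ℝ - q) * heavy M g))
                  + scale * δ * ((1ℝ - p) * 0ℝ + p * (q * δ + (1ℝ - q) * 0ℝ))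
      split = sym (trans
        (solve 11 (λ t p p′ q q′ a b c d k δ →
            con 2 :* (p′ :* a :+ p :* (q :* con 0 :+ q′ :* b)) :+ t :* (p′ :* c :+ p :* (q :* con 0 :+ q′ :* d)) :+ k :* δ :* (p′ :* con 0 :+ p :* (q :* δ :+ q′ :* con 0))
            := p′ :* (con 2 :* a :+ t :* c) :+ p :* (q′ :* (con 2 :* b :+ t :* d) :+ q :* (k :* (δ :* δ))))
          refl t p (1ℝ - p) q (1ℝ - q) (light M f) (light M g) (heavy M f) (heavy M g) scale δ)
        (trans (cong₂ (λ x y → (1ℝ - p) * x + p * ((1ℝ - q) * y + q * E)) (mixed-value M f) (mixed-value M g))
          (trans (cong (λ x → (1ℝ - p) * E + p * x) (convex q)) (convex p))))
        where
        convex : ∀ r → (1ℝ - r) * E + r * E ≡ E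
        convex r = trans (sym (distribʳ E (1ℝ - r) r)) (trans (cong (_* E) (1-p+p≡1 r)) (*-identityˡ E))
      total≤ : E ≤ upper
      total≤ = ≤-trans (≤-reflexive split)
        (+-mono-≤ (+-mono-≤ (*-monoˡ-≤ (#≥0 2) light≤) (*-monoˡ-≤ 0≤t heavy≤))
          (*-monoˡ-≤ (*-nonNegative scale≥0 0≤δ) short≤))
      error≤ : upper ≤ δ * errorBound ρ + ρ * optima M
      error≤ with slack 1≤δ
      ... | e , 0≤e , δ≡ = ≤-slack {z = ρ * ((# 4 + t) * e)}
        (*-nonNegative 0≤ρ (*-nonNegative (+-nonNegative (#≥0 4) 0≤t) 0≤e))
        (trans (solve 7 (λ ρ t M X k δ e →
            con 2 :* (ρ :* (con 0 :+ δ :+ con 1 :+ M :+ (con 0 :+ δ :+ con 1 :+ M))) :+ t :* (ρ :* (M :+ X :+ δ :+ con 1 :+ M :+ X)) :+ k :* δ :* (ρ :* con 4) :+ ρ :* ((con 4 :+ t) :* e)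
            := ρ :* (con 4 :* δ :+ t :* δ :+ (con 4 :+ t) :* (con 1 :+ e) :+ con 4 :* k :* δ) :+ ρ :* (con 4 :* M :+ t :* (M :+ X :+ (M :+ X))))
            refl ρ t M (H M) scale δ e)
          (trans (cong (λ x → ρ * (# 4 * δ + t * δ + (# 4 + t) * x + # 4 * scale * δ) + ρ * optima M) (sym δ≡))
            (cong (_+ ρ * optima M) (solve 4
              (λ ρ t k δ → ρ :* (con 4 :* δ :+ t :* δ :+ (con 4 :+ t) :* δ :+ con 4 :* k :* δ)
                := δ :* (ρ :* (con 2 :* (con 4 :+ t) :+ con 4 :* k)))
              refl ρ t scale δ))))

-- Choice of the parameters and passage to the limit.

module Scales (ℛ : RealNumbers) (A : Exploration.Algorithm ℛ) (greedy : Exploration.ForwardGreedy ℛ A)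
              {t : RealNumbers.ℝ ℛ} (0≤t : RealNumbers._≤_ ℛ (RealNumbers.0ℝ ℛ) t)
              (t²≡2 : RealNumbers._*_ ℛ t t ≡ RealNumbers.2ℝ ℛ) where
  open RealNumbers ℛ
  open OrderedField ℛ
  open Solver using (solve; con; _:+_; _:*_; _:=_)
  open Exploration ℛ
  open Views ℛ
  open Combination ℛ
  open Ratio 0≤t t²≡2

  module Scale (j : ℕ) where
    -- The exponent is positive to ensure `2 ≤ δ`.
    δ : ℝ
    δ = pow2 (suc j)

    m : ℕ
    m = suc j ℕ.+ suc j

    1≤δ : 1ℝ ≤ δ
    1≤δ = 1≤pow2 (suc j)

    0≤δ : 0ℝ ≤ δ
    0≤δ = 0≤pow2 (suc j)

    2≤δ : 2ℝ ≤ δ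
    2≤δ = +-mono-≤ (1≤pow2 j) (1≤pow2 j)

    0≤H : 0ℝ ≤ H (pow2 m)
    0≤H = +-nonNegative (0≤pow2 m) (*-nonNegative 0≤t (0≤pow2 m))

    open LongCycle ℛ m 0≤δ 0≤H
    open ShortCycle ℛ 0≤δ

    0≤M+H : 0ℝ ≤ M + H M
    0≤M+H = +-nonNegative (0≤pow2 m) 0≤H

    module Light = Exploring A greedy ≤-refl
    module Heavy = Exploring A greedy 0≤M+H
    module Short = Tours ℛ shortCycle

    M≡δδ : M ≡ δ * δ
    M≡δδ = pow2-+ (suc j) (suc j)

    δ+1≤M : δ + 1ℝ ≤ M
    δ+1≤M = ≤-trans (+-mono-≤ ≤-refl 1≤δ)
      (subst₂ _≤_ (solve 1 (λ d → d :* con 2 := d :+ d) refl δ) (sym M≡δδ) (*-monoˡ-≤ 0≤δ 2≤δ))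

    M≤tM : M ≤ t * M
    M≤tM = subst (_≤ t * M) (*-identityˡ M) (*-monoʳ-≤ (0≤pow2 m) 1≤t)

    δ≤M : δ ≤ M
    δ≤M = ≤-trans (x≤x+y 0≤1) δ+1≤M

    short-isOpt : Cycle.IsOpt shortCycle (# 4)
    short-isOpt = subst (Cycle.IsOpt shortCycle)
      (solve 0 (con 0 :+ con 1 :+ con 1 :+ con 0 :+ (con 0 :+ con 1 :+ con 1 :+ con 0) := con 4) refl)
      (Short.pathWeight-isOpt (≤-trans
        (≤-reflexive (solve 0 (con 0 :+ con 1 :+ con 1 :+ con 0 := con 2) refl)) 2≤δ))

    -- Avoiding `H` is optimal since the other edges weigh `δ + 1 + M` in total, at most
    -- `M + t * M`.
    light-isOpt : Cycle.IsOpt Light.Γ (0ℝ + δ + 1ℝ + M + (0ℝ + δ + 1ℝ + M))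
    light-isOpt = subst (Cycle.IsOpt Light.Γ) (cong₂ _+_ Light.pathWeight≡ Light.pathWeight≡)
      (Light.pathWeight-isOpt (subst₂ _≤_ (sym Light.pathWeight≡) (sym Light.lastWeight≡)
        (≤-trans (+-mono-≤ (≤-trans (≤-reflexive (cong (_+ 1ℝ) (+-identityˡ δ))) δ+1≤M) M≤tM) ≤-refl)))

    -- No edge exceeds `β = M + H`, and the other edges together weigh more than that, so going
    -- around is optimal.
    heavy-isOpt : Cycle.IsOpt Heavy.Γ (M + H M + δ + 1ℝ + M + H M)
    heavy-isOpt = subst (Cycle.IsOpt Heavy.Γ) Heavy.totalWeight≡ (Heavy.totalWeight-isOpt λ i i<n →
      subst₂ (λ x y → x + x ≤ y) (sym (Heavy.w≡ i<n)) (sym Heavy.totalWeight≡)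
        (≤-trans (+-mono-≤ (w≤ i) (w≤ i)) (≤-slack (+-nonNegative 0≤δ 0≤1)
          (solve 3 (λ M H δ → M :+ H :+ (M :+ H) :+ (δ :+ con 1) := M :+ H :+ δ :+ con 1 :+ M :+ H) refl M
            (H M) δ))))
      where
      M≤M+H : M ≤ M + H M
      M≤M+H = x≤x+y 0≤H
      w≤ : ∀ i → cycleWeight (M + H M) i ≤ M + H M
      w≤ 0 = ≤-refl
      w≤ 1 = ≤-trans δ≤M M≤M+H
      w≤ 2 = ≤-trans (1≤pow2 m) M≤M+H
      w≤ 3 = ≤-trans (1≤pow2 m) M≤M+H
      w≤ (suc (suc (suc (suc k)))) = by-cases (k ℕₚ.<? m)
        where
        by-cases : Dec (k ℕ.< m) → innerWeight (3 ℕ.+ k) ≤ M + H M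
        by-cases (yes k<m) = ≤-trans (≤-reflexive (doubling-weight k<m))
          (≤-trans (pow2-mono-≤ (ℕₚ.<⇒≤ k<m)) M≤M+H)
        by-cases (no k≮m)  = ≤-trans (≤-reflexive (heavy-weight k≮m)) (x≤y+x (0≤pow2 m))

    bound : ∀ {ρ κ} → Competitive A ρ → 0ℝ ≤ κ → (1ℝ + t) * 2ℝ ⁻¹ ≡ ρ + κ → κ * δ ≤ errorBound ρ
    bound {ρ} competitive 0≤κ c≡ = combine M≡δδ 1≤δ 0≤ρ 0≤κ c≡
      (⊩⇒≤short (shortCycle-guarantee A) short-cost)
      (Light.⊩⇒≤ (Light.⊩-whole (Light.top-guarantee none) (Light.top-guarantee detour))
        (competitive Light.Γ Light.s _ light-isOpt))
      (Heavy.⊩⇒≤ (Heavy.⊩-whole (heavy-top none) (heavy-top detour))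
        (competitive Heavy.Γ Heavy.s _ heavy-isOpt))
      where
      open Guarantees ℛ A shortCycle (suc zero) using () renaming (⊩⇒≤ to ⊩⇒≤short; ⊩-spent to ⊩-spent-short)
      open Indistinguishable A greedy ≤-refl 0≤M+H using (directProb-cong)
      short-cost = competitive shortCycle (suc zero) (# 4) short-isOpt
      -- The expected cost on the short cycle is non-negative and the optimum there is positive.
      0≤ρ : 0ℝ ≤ ρ
      0≤ρ = *-cancelˡ-≤ {z = # 4} (0<-mono 0<1 (x≤y+x (#≥0 3)))
        (≤-trans (≤-reflexive (zeroʳ (# 4)))
          (≤-trans (⊩⇒≤short (⊩-spent-short ≤-refl) short-cost) (≤-reflexive (*-comm ρ (# 4)))))
      -- The guarantee is restated with the probability from the light cycle, since `combine` needs
      -- the same `f` and `g` on both.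
      heavy-top : ∀ {b} → Prelude b → top b Heavy.⊩ heavy M (Light.directProb b)
      heavy-top {b} pre = subst (λ f → Heavy._⊩_ (top b) (heavy M f)) (sym (directProb-cong pre))
        (Heavy.HeavyClosing.heavy-top-guarantee refl δ≤M pre)

  -- A smaller `ρ` would leave a gap `κ` whose multiples by all powers of two stay below
  -- `errorBound ρ`, which is independent of the scale; hence `κ ≤ 0`.
  ratio-bound : CompetitiveRatio≥ A ((1ℝ + t) * 2ℝ ⁻¹)
  ratio-bound ρ competitive with ((1ℝ + t) * 2ℝ ⁻¹) ≤? ρ
  ... | yes c≤ρ = c≤ρ
  ... | no ρ<c with slack (<⇒≤ ρ<c)
  ...   | κ , 0≤κ , c≡ = subst₂ _≤_ (sym c≡) (+-identityʳ ρ) (+-mono-≤ ≤-refl (archimedean λ k →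
          ≤-trans (*-monoˡ-≤ 0≤κ (pow2-mono-≤ (ℕₚ.n≤1+n k))) (Scale.bound k competitive 0≤κ c≡)))

theorem4 : (ℛ : RealNumbers) (let open RealNumbers ℛ) (let open Exploration ℛ) →
    (A : Algorithm) → ForwardGreedy A →
    ∀ √2 → 0ℝ ≤ √2 → √2 * √2 ≡ 2ℝ →
    CompetitiveRatio≥ A ((1ℝ + √2) * 2ℝ ⁻¹)
theorem4 ℛ A greedy √2 0≤√2 √2²≡2 = Scales.ratio-bound ℛ A greedy 0≤√2 √2²≡2
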